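{- Let $\Phi$ be a root system of type $D_n$ ($n\ge 4$), $E_6$, $E_7$ or $E_8$, with simple roots $\Pi$ and positive roots $\Phi^+$, and for $t\ge1$ let $\mathcal{I}_t=\{\alpha\in\Phi^+:\mathrm{ht}(\alpha)\ge t\}$. Let $\mathcal{I}$ be an ideal of $\Phi^+$. Then: (i) if $\mathcal{I}\subseteq\mathcal{I}_4$, then $\mathcal{A}_\mathcal{I}$ is not supersolvable; (ii) if $\mathcal{I}\subseteq\mathcal{I}_5$, then $\mathcal{A}_\mathcal{I}$ is not inductively factored.
   Context: Heights $\mathrm{ht}(\sum_{\alpha\in\Pi}c_\alpha\alpha)=\sum c_\alpha$. An ideal of $\Phi^+$ is $\mathcal{I}\subseteq\Phi^+$ with $\alpha\in\mathcal{I},\beta\in\Phi^+,\alpha+\beta\in\Phi^+\Rightarrow\alpha+\beta\in\mathcal{I}$; $\mathcal{I}^c=\Phi^+\setminus\mathcal{I}$; $H_\alpha$ the hyperplane orthogonal to $\alpha$ in $V=\mathbb{R}\otimes\mathbb{Z}\Phi$; $\mathcal{A}_\mathcal{I}=\{H_\alpha:\alpha\in\mathcal{I}^c\}$. For a central arrangement $\mathcal{A}$: $L(\mathcal{A})$ = intersections of subsets of $\mathcal{A}$, ordered by reverse inclusion, rank = codimension; $X\in L(\mathcal{A})$ is modular if $X+Y\in L(\mathcal{A})$ for all $Y\in L(\mathcal{A})$; $\mathcal{A}$ is supersolvable if there is a maximal chain $V=X_0<\cdots<X_r=\bigcap_{H\in\mathcal{A}}H$ of modular elements. Inductively factored: the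 class of pairs $(\mathcal{A},\pi)$, $\pi=(\pi_1,\ldots,\pi_s)$ an ordered partition of $\mathcal{A}$, is the smallest class containing $(\varnothing,())$ in every dimension and containing $(\mathcal{A},\pi)$ whenever some $H_0\in\pi_1$ makes $\mathcal{A}\setminus\pi_1\to\mathcal{A}''$, $H\mapsto H\cap H_0$, bijective (where $\mathcal{A}'=\mathcal{A}\setminus\{H_0\}$, $\mathcal{A}''=\{H_0\cap H:H\in\mathcal{A}'\}$) and $(\mathcal{A}',\pi')$, $(\mathcal{A}'',\pi'')$ are in the class, with $\pi'$ the nonempty $\pi_i\cap\mathcal{A}'$ and $\pi''=(\{H\cap H_0:H\in\pi_i\})_{i=2}^s$; $\mathcal{A}$ is inductively factored if some such $\pi$ exists.
   Formalization: The space V and the hyperplanes H_α are taken over the rational numbers instead of the real numbers (V = ℚ⊗ℤΦ); intersections, modularity and factorizations are those of rational subspaces. -}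

module Defs where

open import Data.Nat as ℕ using (ℕ; zero; suc)
open import Data.Integer as ℤ using (ℤ; +_; -[1+_])
open import Data.Rational as ℚ using (ℚ; 0ℚ)
open import Data.Fin using (Fin; toℕ)
open import Data.Vec using (Vec; []; _∷_; tabulate; lookup; zipWith; foldr)
open import Data.List using (List; []; _∷_)
open import Data.Bool.ListAction using (any)
open import Data.Bool using (Bool; true; false; if_then_else_; _∨_; _∧_)
open import Data.Product using (Σ; ∃; _×_; _,_)
open import Relation.Binary.PropositionalEquality using (_≡_; _≢_)
open import Relation.Nullary using (¬_)
open import Data.Empty using (⊥)

data ADE : Set where
  D  : (k : ℕ) → ADE      -- D k  denotes the type D_(k+4)
  E6 E7 E8 : ADE

rank : ADE → ℕ
rank (D k) = k ℕ.+ 4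
rank E6 = 6
rank E7 = 7
rank E8 = 8

-- edges of the Dynkin diagram, vertices numbered 0 .. rank-1 (Bourbaki order)
chain : ℕ → List (ℕ × ℕ)
chain zero = []
chain (suc m) = (m , suc m) ∷ chain m

edgesD : ℕ → List (ℕ × ℕ)
edgesD k = (k ℕ.+ 1 , k ℕ.+ 3) ∷ chain (k ℕ.+ 2)

-- E_n : 0-2, 2-3, ..., (n-2)-(n-1), plus 1-3
edgesE : ℕ → List (ℕ × ℕ)
edgesE n = (0 , 2) ∷ (1 , 3) ∷ chainFrom2 n
  where
  chainFrom2 : ℕ → List (ℕ × ℕ)
  chainFrom2 m = go m
    where
    go : ℕ → List (ℕ × ℕ)
    go zero = []
    go (suc j) = if 4 ℕ.≤ᵇ suc j then (j ℕ.∸ 1 , j) ∷ go j else go j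

edges : ADE → List (ℕ × ℕ)
edges (D k) = edgesD k
edges E6 = edgesE 6
edges E7 = edgesE 7
edges E8 = edgesE 8

adjacent : ADE → ℕ → ℕ → Bool
adjacent T a b = any (λ { (x , y) → ((x ℕ.≡ᵇ a) ∧ (y ℕ.≡ᵇ b)) ∨ ((x ℕ.≡ᵇ b) ∧ (y ℕ.≡ᵇ a)) }) (edges T)

cartan : (T : ADE) → Fin (rank T) → Fin (rank T) → ℤ
cartan T i j =
  if toℕ i ℕ.≡ᵇ toℕ j then + 2
  else if adjacent T (toℕ i) (toℕ j) then -[1+ 0 ] else + 0

-- Roots in coordinates w.r.t. the simple roots Π

Coord : ADE → Set
Coord T = Vec ℤ (rank T)

sumℤ : ∀ {m} → Vec ℤ m → ℤ
sumℤ = foldr _ ℤ._+_ (+ 0)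

simple : (T : ADE) → Fin (rank T) → Coord T
simple T i = tabulate (λ j → if toℕ i ℕ.≡ᵇ toℕ j then + 1 else + 0)

pairing : (T : ADE) → Coord T → Fin (rank T) → ℤ
pairing T x i = sumℤ (tabulate (λ j → lookup x j ℤ.* cartan T j i))

reflect : (T : ADE) → Fin (rank T) → Coord T → Coord T
reflect T i x = tabulate (λ j → lookup x j ℤ.- pairing T x i ℤ.* lookup (simple T i) j)

-- Φ = W·Π (orbit of the simple roots under the Weyl group)
data Root (T : ADE) : Coord T → Set where
  simpleRoot : ∀ i → Root T (simple T i)
  reflRoot   : ∀ i {x} → Root T x → Root T (reflect T i x)

Positive : (T : ADE) → Coord T → Set
Positive T α = Root T α × (∀ j → + 0 ℤ.≤ lookup α j)

height : (T : ADE) → Coord T → ℤ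
height T α = sumℤ α

addC : (T : ADE) → Coord T → Coord T → Coord T
addC T = zipWith ℤ._+_

IsIdeal : (T : ADE) → (Coord T → Set) → Set
IsIdeal T I =
  (∀ α → I α → Positive T α) ×
  (∀ α β → I α → Positive T β → Positive T (addC T α β) → I (addC T α β))

Iht : (T : ADE) → ℕ → Coord T → Set
Iht T t α = Positive T α × (+ t ℤ.≤ height T α)

-- The space V = ℚ ⊗ ℤΦ in simple-root coordinates, subspaces as predicates

VecQ : ℕ → Set
VecQ m = Vec ℚ m

Sub : ℕ → Set₁
Sub m = VecQ m → Set

_≈S_ : ∀ {m} → Sub m → Sub m → Set
X ≈S Y = ∀ v → (X v → Y v) × (Y v → X v)

_⊆S_ : ∀ {m} → Sub m → Sub m → Set
X ⊆S Y = ∀ v → X v → Y v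

_⊊S_ : ∀ {m} → Sub m → Sub m → Set
X ⊊S Y = X ⊆S Y × ¬ (Y ⊆S X)

_∩S_ : ∀ {m} → Sub m → Sub m → Sub m
(X ∩S Y) v = X v × Y v

_+S_ : ∀ {m} → Sub m → Sub m → Sub m
(X +S Y) v = ∃ λ x → ∃ λ y → X x × Y y × v ≡ zipWith ℚ._+_ x y

fullS : ∀ {m} → Sub m
fullS v = Data.Unit.⊤
  where import Data.Unit

sumℚ : ∀ {m} → Vec ℚ m → ℚ
sumℚ = foldr _ ℚ._+_ 0ℚ

toℚ : ℤ → ℚ
toℚ z = z ℚ./ 1

-- hyperplane H_α orthogonal to α (inner product given by the Cartan matrix)
Hyp : (T : ADE) → Coord T → Sub (rank T)
Hyp T α v =
  sumℚ (tabulate (λ i → sumℚ (tabulate (λ j →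
     toℚ (lookup α i ℤ.* cartan T i j) ℚ.* lookup v j)))) ≡ 0ℚ

-- Arrangements: a set of names (predicate M on a name type N) together
-- with an assignment of hyperplanes H : N → Sub m.

module _ {m : ℕ} {N : Set} where

  ⋂ : (N → Sub m) → (N → Set) → Sub m
  ⋂ H S v = ∀ x → S x → H x v

  InL : (N → Sub m) → (N → Set) → Sub m → Set₁
  InL H M X = Σ (N → Set) λ S → (∀ x → S x → M x) × (X ≈S ⋂ H S)

  Modular : (N → Sub m) → (N → Set) → Sub m → Set₁
  Modular H M X = InL H M X × (∀ Y → InL H M Y → InL H M (X +S Y))

  -- X covers Y in L(A) (order = reverse inclusion): Y ⊊ X with nothing between
  Covers : (N → Sub m) → (N → Set) → Sub m → Sub m → Set₁
  Covers H M X Y = (Y ⊊S X) × (∀ Z → InL H M Z → Y ⊊S Z → ¬ (Z ⊊S X))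

  data ModChainFrom (H : N → Sub m) (M : N → Set) : Sub m → Set₁ where
    done : ∀ {X} → Modular H M X → X ≈S ⋂ H M → ModChainFrom H M X
    next : ∀ {X Y} → Modular H M X → Covers H M X Y →
           ModChainFrom H M Y → ModChainFrom H M X

  Supersolvable : (N → Sub m) → (N → Set) → Set₁
  Supersolvable H M = ModChainFrom H M fullS

  -- Inductively factored.  An ordered partition π = (π₁,…,π_s) is encoded by
  -- a labelling lab : N → ℕ; the blocks are the nonempty fibres of lab on M,
  -- ordered by label (so π₁ = the names of minimal label).
  data IndFact : (N → Sub m) → (N → Set) → (N → ℕ) → Set₁ where
    empty : ∀ {H M lab} → (∀ x → ¬ M x) → IndFact H M lab
    step  : ∀ {H M lab} (x₀ : N) → M x₀ →
      -- H₀ = H x₀ ∈ π₁ ; π₁ = { y ∈ M | lab y ≡ lab x₀ }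
      (∀ y → M y → lab x₀ ℕ.≤ lab y) →
      -- A ∖ π₁ → A'' , H ↦ H ∩ H₀ is injective ...
      (∀ x y → M x → M y → lab x₀ ℕ.< lab x → lab x₀ ℕ.< lab y →
         (H x ∩S H x₀) ≈S (H y ∩S H x₀) → x ≡ y) →
      -- ... and surjective onto A'' = { H ∩ H₀ | H ∈ A' }
      (∀ y → M y → lab y ≡ lab x₀ → y ≢ x₀ →
         ∃ λ x → M x × lab x₀ ℕ.< lab x × ((H y ∩S H x₀) ≈S (H x ∩S H x₀))) →
      IndFact H (λ y → M y × y ≢ x₀) lab →
      -- (A'', π'') ∈ class, A'' indexed by A ∖ π₁
      IndFact (λ y → H y ∩S H x₀) (λ y → M y × lab x₀ ℕ.< lab y) lab →
      IndFact H M lab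

  InductivelyFactored : (N → Sub m) → (N → Set) → Set₁
  InductivelyFactored H M = Σ (N → ℕ) λ lab → IndFact H M lab

AI-names : (T : ADE) → (Coord T → Set) → Coord T → Set
AI-names T I α = Positive T α × ¬ I α

{-# OPTIONS --safe #-}
module Submission where

-- All types contain D₄.  In D₄ label the roots other than the highest one by the
-- Klein four-group, l i (i ≠ 0), c j and d k, so that the c's are mutually
-- orthogonal, the d's are mutually orthogonal, and the 12 "lines" l i, c j,
-- d (i + j) are coplanar triples.  The blocks of an inductive factorization, and
-- likewise the levels given by a chain of modular flats, separate orthogonal
-- roots (no third root is coplanar with them) and put two roots of every line
-- together.  Recording such a pair by (i, second or third) or by (j, third)
-- determines the line, and there are only 3 + 3 + 4 = 10 records for 12 lines:
-- this proves (ii).  Among the roots of height at most 3, i.e. without c 0, there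
-- are 9 records for 9 lines, so every record occurs exactly once.  A pair c j, d k
-- of equal level has l i strictly below it, and l i has the level of some c j';
-- so there is no lowest c, which proves (i).
--
-- That no other root is coplanar with two orthogonal roots uses that the Cartan
-- matrix is nondegenerate and that every root has norm 2.

open import Defs
open import Data.Nat as ℕ using (ℕ; zero; suc; z≤n; s≤s)
import Data.Nat.Properties as ℕP
import Data.Nat.Coprimality as Coprime
open import Data.Nat.Induction using (<-wellFounded)
open import Induction.WellFounded using (Acc; acc)
open import Data.Integer as ℤ using (ℤ; +_; -[1+_]; _+_; _*_; -_; ∣_∣)
import Data.Integer.Properties as ℤP
open import Data.Integer.Tactic.RingSolver using (solve-∀)
open import Data.Rational as ℚ using (ℚ; 0ℚ; mkℚ)
import Data.Rational.Properties as ℚP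
open import Data.Fin as Fin using (Fin; zero; suc; toℕ; _↑ʳ_; join; splitAt; combine; remQuot; punchOut)
import Data.Fin.Properties as FP
open import Data.Fin.Patterns
open import Data.Vec using (Vec; []; _∷_; lookup; tabulate; zipWith; replicate)
import Data.Vec.Properties as VP
open import Data.Bool using (Bool; true; false; if_then_else_; _∧_; _∨_)
import Data.Bool.Properties as BP
open import Data.List using ([]; _∷_)
open import Data.Bool.ListAction using (any)
open import Data.Product using (∃; _×_; _,_; proj₁; proj₂; uncurry)
open import Data.Sum using (_⊎_; inj₁; inj₂; [_,_])
open import Data.Empty using (⊥; ⊥-elim)
open import Data.Unit using (⊤; tt)
open import Relation.Nullary using (¬_; Dec; yes; no; contradiction; ¬?; _→-dec_; _×-dec_)
open import Relation.Nullary.Decidable using (from-yes; ¬¬-excluded-middle)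
open import Relation.Binary.Definitions using (DecidableEquality)
open import Relation.Binary.PropositionalEquality hiding ([_])
open import Function using (_∘_; _$_)
open import Function.Definitions using (Injective)
open import Algebra.Properties.Semiring.Sum ℤP.+-*-semiring
open import Algebra.Properties.CommutativeMonoid.Sum ℚP.+-0-commutativeMonoid
  using () renaming (sum to sumQ; sum-cong-≗ to sumQ-cong; ∑-distrib-+ to sumQ-distrib; sum-replicate-zero to sumQ-zero)
open ≡-Reasoning

-- Pigeonhole on lines

-- A missed value could be punched out, leaving an injection of `Fin (suc n)` into `Fin n`.
injective⇒surjective : ∀ {n} {f : Fin n → Fin n} → Injective _≡_ _≡_ f → ∀ y → ∃ λ x → f x ≡ y
injective⇒surjective {suc n} {f} inj y with FP.any? (λ x → f x Fin.≟ y)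
... | yes hit = hit
... | no miss = ⊥-elim (ℕP.1+n≰n (FP.injective⇒≤ {f = λ x → punchOut (avoid x)}
                  (λ {x} {x'} eq → inj (FP.punchOut-injective (avoid x) (avoid x') eq))))
  where
  avoid : ∀ x → y ≢ f x
  avoid x eq = miss (x , sym eq)

-- Every line (i , j) carries two points of equal level, and such a pair is
-- recorded in one of the slots "i with some second point", "i with some third
-- point", "j with some third point".  Injectivity of the levels on the second
-- and on the third points makes a slot determine its line.
module Levels {p n q : ℕ} (first : Fin p → ℕ) (second : Fin n → ℕ) (third : Fin q → ℕ)
  (e : Fin p → Fin n → Fin q)
  (e-injˡ : ∀ {i i'} j → e i j ≡ e i' j → i ≡ i')
  (e-injʳ : ∀ i {j j'} → e i j ≡ e i j' → j ≡ j')
  (second-inj : Injective _≡_ _≡_ second)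
  (third-inj : Injective _≡_ _≡_ third) where

  Line Slot : Set
  Line = Fin p × Fin n
  Slot = Fin p ⊎ (Fin p ⊎ Fin n)

  data Hit : Line → Slot → Set where
    first-second : ∀ {i j} → first i ≡ second j → Hit (i , j) (inj₁ i)
    first-third  : ∀ {i j} → first i ≡ third (e i j) → Hit (i , j) (inj₂ (inj₁ i))
    second-third : ∀ {i j} → second j ≡ third (e i j) → Hit (i , j) (inj₂ (inj₂ j))

  hit-injective : ∀ {k k' s} → Hit k s → Hit k' s → k ≡ k'
  hit-injective (first-second {i} a) (first-second b) = cong (i ,_) (second-inj (trans (sym a) b))
  hit-injective (first-third {i} a) (first-third b) = cong (i ,_) (e-injʳ i (third-inj (trans (sym a) b)))
  hit-injective (second-third {j = j} a) (second-third b) = cong (_, j) (e-injˡ j (third-inj (trans (sym a) b)))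

  module _ (choice : ∀ k → ∃ (Hit k)) where

    encode : Slot → Fin (p ℕ.+ (p ℕ.+ n))
    encode (inj₁ i) = join p _ (inj₁ i)
    encode (inj₂ s) = join p _ (inj₂ (join p n s))

    decode : Fin (p ℕ.+ (p ℕ.+ n)) → Slot
    decode x with splitAt p x
    ... | inj₁ i = inj₁ i
    ... | inj₂ y = inj₂ (splitAt p y)

    decode-encode : ∀ s → decode (encode s) ≡ s
    decode-encode (inj₁ i) rewrite FP.splitAt-join p (p ℕ.+ n) (inj₁ i) = refl
    decode-encode (inj₂ s) rewrite FP.splitAt-join p (p ℕ.+ n) (inj₂ (join p n s)) = cong inj₂ (FP.splitAt-join p n s)

    encode-injective : Injective _≡_ _≡_ encode
    encode-injective {s} {s'} eq = trans (sym (decode-encode s)) (trans (cong decode eq) (decode-encode s'))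

    slot : Fin (p ℕ.* n) → Fin (p ℕ.+ (p ℕ.+ n))
    slot x = encode (proj₁ (choice (remQuot n x)))

    slot-injective : Injective _≡_ _≡_ slot
    slot-injective {x} {x'} eq =
      trans (sym (FP.combine-remQuot {p} n x)) (trans (cong (uncurry combine)
        (hit-injective (proj₂ (choice (remQuot n x)))
          (subst (Hit _) (sym (encode-injective eq)) (proj₂ (choice (remQuot n x'))))))
        (FP.combine-remQuot {p} n x'))

    lines≤slots : p ℕ.* n ℕ.≤ p ℕ.+ (p ℕ.+ n)
    lines≤slots = FP.injective⇒≤ slot-injective

    module _ (lines≡slots : p ℕ.* n ≡ p ℕ.+ (p ℕ.+ n)) where

      -- With as many slots as lines, `slot` becomes an injective self-map of a finite set, hence
      -- hits everything.
      slot-used : ∀ s → ∃ λ k → proj₁ (choice k) ≡ s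
      slot-used s with injective⇒surjective {f = slot ∘ Fin.cast (sym lines≡slots)}
                         (λ {x} {x'} eq → cast-injective (slot-injective eq)) (encode s)
        where
        cast-injective : ∀ {x x'} → Fin.cast (sym lines≡slots) x ≡ Fin.cast (sym lines≡slots) x' → x ≡ x'
        cast-injective {x} {x'} eq = FP.toℕ-injective
          (trans (sym (FP.toℕ-cast _ x)) (trans (cong Fin.toℕ eq) (FP.toℕ-cast _ x')))
      ... | x , eq = _ , encode-injective eq

      -- Some line `k'` has chosen `s`, and a slot determines its line, so `k` is `k'`: no line has
      -- a hit besides its chosen one.
      hit-unique : ∀ {k s} → Hit k s → proj₁ (choice k) ≡ s
      hit-unique {s = s} h with slot-used s
      ... | k' , refl = cong (proj₁ ∘ choice) (hit-injective h (proj₂ (choice k')))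

      module _ (dominated : ∀ i j → second j ≡ third (e i j) → first i ℕ.≤ second j) where

        -- The slot `second-third` of `j` is used by some line `(i , j)`, so `first i` is at most
        -- `second j`; the slot `first-second` of `i` then supplies `j'` with `second j'` equal to
        -- `first i`. If `first i` equalled `second j`, the line `(i , j)` would have two hits.
        descend : ∀ j → ∃ λ j' → second j' ℕ.< second j
        descend j with slot-used (inj₂ (inj₂ j))
        ... | k , eq with subst (Hit k) eq (proj₂ (choice k))
        ... | second-third {i} c≡d with slot-used (inj₁ i)
        ... | k' , eq' with subst (Hit k') eq' (proj₂ (choice k'))
        ... | first-second {j = j'} l≡c = j' , subst (ℕ._< second j) l≡c
                (ℕP.≤∧≢⇒< (dominated i j c≡d) λ l≡c' → absurd (trans (sym eq) (hit-unique (first-second l≡c'))))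
          where
          absurd : _≡_ {A = Slot} (inj₂ (inj₂ j)) (inj₁ i) → ⊥
          absurd ()

        no-levels : Fin n → ⊥
        no-levels j = go j (<-wellFounded _)
          where
          go : ∀ j → Acc ℕ._<_ (second j) → ⊥
          go j (acc rec) = let j' , lt = descend j in go j' (rec lt)

-- Rank two localizations of inductive factorizations

-- For distinct hyperplanes: they share one codimension two space, that is, their normals are
-- coplanar. Inclusions alone express this.
record Collinear {m} (X Y Z : Sub m) : Set where
  field
    meet₁₂ : (X ∩S Y) ⊆S Z
    meet₁₃ : (X ∩S Z) ⊆S Y
    meet₂₃ : (Y ∩S Z) ⊆S X

module _ {m : ℕ} {N : Set} (_≟_ : DecidableEquality N) where

  module _ {H : N → Sub m} {lab : N → ℕ} where

    -- Until a point of the line is removed nothing happens to the line; when the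
    -- first one is, the two others have the same restriction.
    collinear⇒share-label : ∀ {M a b c} → Collinear (H a) (H b) (H c) → a ≢ b → a ≢ c → b ≢ c →
      IndFact H M lab → M a → M b → M c → ¬ (lab a ≢ lab b × lab a ≢ lab c × lab b ≢ lab c)
    collinear⇒share-label {M} {a} {b} {c} l a≢b a≢c b≢c fact Ma Mb Mc (ab , ac , bc) = go fact Ma Mb Mc
      where
      open Collinear l

      go : ∀ {M} → IndFact H M lab → M a → M b → M c → ⊥
      go (empty none) Ma _ _ = none a Ma
      go (step x₀ _ minimal injective _ rest _) Ma Mb Mc with x₀ ≟ a | x₀ ≟ b | x₀ ≟ c
      ... | yes refl | _ | _ = b≢c (injective b c Mb Mc
              (ℕP.≤∧≢⇒< (minimal b Mb) ab) (ℕP.≤∧≢⇒< (minimal c Mc) ac)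
              λ v → (λ (Hb , Ha) → meet₁₂ v (Ha , Hb) , Ha) , (λ (Hc , Ha) → meet₁₃ v (Ha , Hc) , Ha))
      ... | no _ | yes refl | _ = a≢c (injective a c Ma Mc
              (ℕP.≤∧≢⇒< (minimal a Ma) (≢-sym ab)) (ℕP.≤∧≢⇒< (minimal c Mc) bc)
              λ v → (λ (Ha , Hb) → meet₁₂ v (Ha , Hb) , Hb) , (λ (Hc , Hb) → meet₂₃ v (Hb , Hc) , Hb))
      ... | no _ | no _ | yes refl = a≢b (injective a b Ma Mb
              (ℕP.≤∧≢⇒< (minimal a Ma) (≢-sym ac)) (ℕP.≤∧≢⇒< (minimal b Mb) (≢-sym bc))
              λ v → (λ (Ha , Hc) → meet₁₃ v (Ha , Hc) , Hc) , (λ (Hb , Hc) → meet₂₃ v (Hb , Hc) , Hc))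
      ... | no x₀≢a | no x₀≢b | no x₀≢c =
              go rest (Ma , ≢-sym x₀≢a) (Mb , ≢-sym x₀≢b) (Mc , ≢-sym x₀≢c)

    -- Deletions leave the pair alone until one of the two is `x₀`. If the other lay in the same
    -- block, some `x` of larger label would have the same restriction; `only` makes `x` one of the
    -- two, whose labels are minimal.
    generic⇒distinct-labels : ∀ {M a b} → a ≢ b →
      (∀ x → M x → (H a ∩S H b) ⊆S H x → x ≡ a ⊎ x ≡ b) →
      IndFact H M lab → M a → M b → lab a ≢ lab b
    generic⇒distinct-labels {a = a} {b} a≢b only (empty none) Ma Mb eq = none a Ma
    generic⇒distinct-labels {a = a} {b} a≢b only (step x₀ Mx₀ minimal injective surjective rest _) Ma Mb eq
      with x₀ ≟ a | x₀ ≟ b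
    ... | yes refl | _ with surjective b Mb (sym eq) (≢-sym a≢b)
    ...   | x , Mx , lt , same with only x Mx (λ v (Ha , Hb) → proj₁ (proj₁ (same v) (Hb , Ha)))
    ...     | inj₁ refl = ℕP.<-irrefl refl lt
    ...     | inj₂ refl = ℕP.<-irrefl eq lt
    generic⇒distinct-labels {a = a} {b} a≢b only (step x₀ Mx₀ minimal injective surjective rest _) Ma Mb eq
        | no _ | yes refl with surjective a Ma eq a≢b
    ...   | x , Mx , lt , same with only x Mx (λ v (Ha , Hb) → proj₁ (proj₁ (same v) (Ha , Hb)))
    ...     | inj₁ refl = ℕP.<-irrefl (sym eq) lt
    ...     | inj₂ refl = ℕP.<-irrefl refl lt
    generic⇒distinct-labels {a = a} {b} a≢b only (step x₀ Mx₀ minimal injective surjective rest _) Ma Mb eq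
        | no x₀≢a | no x₀≢b = generic⇒distinct-labels a≢b (λ x (Mx , _) → only x Mx)
            rest (Ma , ≢-sym x₀≢a) (Mb , ≢-sym x₀≢b) eq

-- Levels of modular chains

-- Double-negated choice, so that the level of a hyperplane in a chain of flats
-- can be used although inclusion of subspaces is undecidable.
Omniscient : Set → Set₁
Omniscient A = {P : A → Set} → (∀ x → ¬ ¬ P x) → ¬ ¬ (∀ x → P x)

omniscient-Fin : ∀ n → Omniscient (Fin n)
omniscient-Fin zero    f k = k λ ()
omniscient-Fin (suc n) f k = f zero λ p → omniscient-Fin n (f ∘ suc) λ ps → k λ { zero → p ; (suc i) → ps i }

omniscient-⊎ : ∀ {A B} → Omniscient A → Omniscient B → Omniscient (A ⊎ B)
omniscient-⊎ choiceᴬ choiceᴮ f k =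
  choiceᴬ (f ∘ inj₁) λ p → choiceᴮ (f ∘ inj₂) λ q → k [ p , q ]

_⊕_ : ∀ {m} → VecQ m → VecQ m → VecQ m
_⊕_ = zipWith ℚ._+_

0ᵛ : ∀ {m} → VecQ m
0ᵛ = replicate _ 0ℚ

record IsLinear {m} (X : Sub m) : Set where
  field
    has-0      : X 0ᵛ
    +-closed   : ∀ {u v} → X u → X v → X (u ⊕ v)
    +-cancelʳ  : ∀ {u v} → X (u ⊕ v) → X v → X u

module _ {m : ℕ} {N : Set} (H : N → Sub m) (M : N → Set) (linear : ∀ x → IsLinear (H x)) where

  open module L x = IsLinear (linear x)

  -- By `only`, no third hyperplane of the arrangement contains the intersection; `separated`
  -- provides the vector to be decomposed along a modular sum.
  record Generic (a b : N) : Set where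
    field
      only      : ∀ x → M x → (H a ∩S H b) ⊆S H x → x ≡ a ⊎ x ≡ b
      separated : ∃ λ v → H a v × ¬ H b v

  flat-has-0 : ∀ {X} → InL H M X → X 0ᵛ
  flat-has-0 (S , _ , X≈) = proj₂ (X≈ 0ᵛ) λ x _ → has-0 x

  hyperplane∩hyperplane : ∀ {a b} → M a → M b → InL H M (H a ∩S H b)
  hyperplane∩hyperplane {a} {b} Ma Mb = (λ x → x ≡ a ⊎ x ≡ b) ,
    (λ { _ (inj₁ refl) → Ma ; _ (inj₂ refl) → Mb }) ,
    λ v → (λ { (Ha , Hb) _ (inj₁ refl) → Ha ; (Ha , Hb) _ (inj₂ refl) → Hb }) ,
          λ h → h a (inj₁ refl) , h b (inj₂ refl)

  flat∩hyperplane : ∀ {X a} → InL H M X → M a → InL H M (X ∩S H a)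
  flat∩hyperplane {a = a} (S , S⊆M , X≈) Ma = (λ x → S x ⊎ x ≡ a) ,
    (λ { x (inj₁ s) → S⊆M x s ; _ (inj₂ refl) → Ma }) ,
    λ v → (λ { (Xv , _) x (inj₁ s) → proj₁ (X≈ v) Xv x s ; (_ , Ha) _ (inj₂ refl) → Ha }) ,
          λ h → proj₂ (X≈ v) (λ x s → h x (inj₁ s)) , h a (inj₂ refl)

  -- By modularity X + (H a ∩ H b) is a flat; the hyperplanes through it contain
  -- H a ∩ H b but neither of them is H a or H b, so it is the whole space.  But
  -- if Y lies in both hyperplanes, a vector of H a decomposed along the sum has
  -- its X-part in X ∩ H a = Y, hence lies in H b.
  modular-cover-generic : ∀ {X Y a b} → Modular H M X → Covers H M X Y → Generic a b → M a → M b →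
    ¬ (X ⊆S H a) → ¬ (X ⊆S H b) → ¬ (Y ⊆S H a × Y ⊆S H b)
  modular-cover-generic {X} {Y} {a} {b} (flatX , modular) ((Y⊆X , X⊈Y) , covers) generic Ma Mb X⊈a X⊈b (Y⊆a , Y⊆b)
    with modular _ (hyperplane∩hyperplane Ma Mb)
  -- Equality of `X ∩S H a` with `Y` is not derived: the cover condition refutes that this flat lies
  -- strictly between `Y` and `X`, and `decompose` works under the assumed inclusion.
  ... | S , S⊆M , sum≈ = covers (X ∩S H a) (flat∩hyperplane flatX Ma)
          ((λ v Yv → Y⊆X v Yv , Y⊆a v Yv) , λ ⊆Y → ¬Hbv (decompose ⊆Y))
          ((λ _ → proj₁) , λ X⊆ → X⊈a λ v Xv → proj₂ (X⊆ v Xv))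
    where
    open Generic generic
    v : VecQ m
    v = proj₁ separated
    Hav : H a v
    Hav = proj₁ (proj₂ separated)
    ¬Hbv : ¬ H b v
    ¬Hbv = proj₂ (proj₂ separated)

    S-empty : ∀ x → ¬ S x
    S-empty x s = [ (λ { refl → X⊈a X⊆x }) , (λ { refl → X⊈b X⊆x }) ] (only x (S⊆M x s) line⊆x)
      where
      X⊆x : X ⊆S H x
      X⊆x w Xw = proj₁ (sum≈ w) (w , 0ᵛ , Xw , (has-0 a , has-0 b) ,
                   sym (VP.zipWith-identityʳ ℚP.+-identityʳ w)) x s
      line⊆x : (H a ∩S H b) ⊆S H x
      line⊆x w Hw = proj₁ (sum≈ w) (0ᵛ , w , flat-has-0 flatX , Hw ,
                   sym (VP.zipWith-identityˡ ℚP.+-identityˡ w)) x s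

    decompose : (X ∩S H a) ⊆S Y → H b v
    decompose ⊆Y with proj₂ (sum≈ v) (λ x s → contradiction s (S-empty x))
    ... | x , u , Xx , (Hau , Hbu) , v≡x+u = subst (H b) (sym v≡x+u)
            (+-closed b (Y⊆b x (⊆Y x (Xx , +-cancelʳ a (subst (H a) v≡x+u Hav) Hau))) Hbu)

  module _ {A : Set} (name : A → N) where

    -- level i is the number of flats in the chain starting at X that are not
    -- contained in H (name i).
    record LevelsFrom (X : Sub m) (level : A → ℕ) : Set where
      field
        zero⇒⊆   : ∀ {i} → level i ≡ 0 → X ⊆S H (name i)
        ⊆⇒zero   : ∀ {i} → X ⊆S H (name i) → level i ≡ 0
        generic  : ∀ {i j} → Generic (name i) (name j) → level i ≡ level j → level i ≡ 0
        span     : ∀ {i j k} → (H (name i) ∩S H (name j)) ⊆S H (name k) →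
                   ∀ {l} → level i ℕ.≤ l → level j ℕ.≤ l → level k ℕ.≤ l

    -- Levels are built from the end of the chain backwards: prepending `X` keeps level 0 for
    -- hyperplanes containing `X` and raises every other level by one. Deciding which ones contain
    -- `X` costs the double negation.
    levelsFrom : Omniscient A → (∀ i → M (name i)) → ∀ {X} → ModChainFrom H M X → ¬ ¬ ∃ (LevelsFrom X)
    levelsFrom choice in-M {X} (done _ X≈) k = k ((λ _ → 0) , record
      { zero⇒⊆ = λ {i} _ v Xv → proj₁ (X≈ v) Xv (name i) (in-M i)
      ; ⊆⇒zero = λ _ → refl
      ; generic = λ _ _ → refl
      ; span = λ _ _ _ → z≤n })
    levelsFrom choice in-M {X} (next {Y = Y} modular cover@((Y⊆X , _) , _) chain) k =
      levelsFrom choice in-M chain λ (level , levels) → choice (λ _ → ¬¬-excluded-middle) λ X⊆? → k (_ , extend level levels X⊆?)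
      where
      module _ (level : A → ℕ) (levels : LevelsFrom Y level) (X⊆? : ∀ i → Dec (X ⊆S H (name i))) where
        open LevelsFrom levels

        level′ : A → ℕ
        level′ i with X⊆? i
        ... | yes _ = 0
        ... | no _  = suc (level i)

        zero⇒⊆′ : ∀ {i} → level′ i ≡ 0 → X ⊆S H (name i)
        zero⇒⊆′ {i} eq with X⊆? i
        ... | yes X⊆i = X⊆i

        ⊆⇒zero′ : ∀ {i} → X ⊆S H (name i) → level′ i ≡ 0
        ⊆⇒zero′ {i} X⊆i with X⊆? i
        ... | yes _   = refl
        ... | no X⊈i = contradiction X⊆i X⊈i

        -- Equal positive levels over `X` come from equal levels over `Y`, which are 0 by induction;
        -- both hyperplanes then contain `Y` but not `X`, against `modular-cover-generic`.
        generic′ : ∀ {i j} → Generic (name i) (name j) → level′ i ≡ level′ j → level′ i ≡ 0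
        generic′ {i} {j} g eq with X⊆? i | X⊆? j
        ... | yes _   | _ = refl
        ... | no X⊈i | no X⊈j = ⊥-elim (modular-cover-generic modular cover g (in-M i) (in-M j) X⊈i X⊈j
                (zero⇒⊆ i≡0 , zero⇒⊆ (trans (sym i≡j) i≡0)))
          where
          i≡j : level i ≡ level j
          i≡j = ℕP.suc-injective eq
          i≡0 : level i ≡ 0
          i≡0 = generic g i≡j

        pred-bound : ∀ {i l} → level′ i ℕ.≤ suc l → level i ℕ.≤ l
        pred-bound {i} i≤ with X⊆? i
        ... | yes X⊆i = subst (ℕ._≤ _) (sym (⊆⇒zero (λ v Yv → X⊆i v (Y⊆X v Yv)))) z≤n
        ... | no _    = ℕP.≤-pred i≤

        -- A level is at most `l` when the flat `l` steps down the chain lies in the hyperplane, a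
        -- condition that passes to any hyperplane through the intersection. For `l = 0` that flat
        -- is `X`.
        span′ : ∀ {i j k} → (H (name i) ∩S H (name j)) ⊆S H (name k) →
                ∀ {l} → level′ i ℕ.≤ l → level′ j ℕ.≤ l → level′ k ℕ.≤ l
        span′ {i} {j} {k} ij⊆k {zero} i≤ j≤ = ℕP.≤-reflexive (⊆⇒zero′ {k} λ v Xv →
          ij⊆k v (zero⇒⊆′ {i} (ℕP.n≤0⇒n≡0 i≤) v Xv , zero⇒⊆′ {j} (ℕP.n≤0⇒n≡0 j≤) v Xv))
        span′ {i} {j} {k} ij⊆k {suc l} i≤ j≤ with X⊆? k
        ... | yes _ = z≤n
        ... | no _  = s≤s (span ij⊆k (pred-bound {i} i≤) (pred-bound {j} j≤))

        extend : LevelsFrom X level′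
        extend = record { zero⇒⊆ = λ {i} → zero⇒⊆′ {i} ; ⊆⇒zero = ⊆⇒zero′
                        ; generic = generic′ ; span = λ {i} {j} {k} → span′ {i} {j} {k} }

-- Integral bilinear forms

lookup-ext : ∀ {A : Set} {n} {u v : Vec A n} → (∀ i → lookup u i ≡ lookup v i) → u ≡ v
lookup-ext {u = u} {v} eq = trans (sym (VP.tabulate∘lookup u)) (trans (VP.tabulate-cong eq) (VP.tabulate∘lookup v))

sumℤ-tabulate : ∀ {n} (f : Fin n → ℤ) → sumℤ (tabulate f) ≡ sum f
sumℤ-tabulate {zero}  f = refl
sumℤ-tabulate {suc n} f = cong (_+_ (f zero)) (sumℤ-tabulate (f ∘ suc))

sumℤ-zipWith : ∀ {n} (x y : Vec ℤ n) → sumℤ (zipWith _+_ x y) ≡ sumℤ x + sumℤ y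
sumℤ-zipWith []      []      = refl
sumℤ-zipWith (a ∷ x) (b ∷ y) = trans (cong (_+_ (a + b)) (sumℤ-zipWith x y))
  (interchange a b (sumℤ x) (sumℤ y))
  where
  interchange : ∀ a b c d → (a + b) + (c + d) ≡ (a + c) + (b + d)
  interchange = solve-∀

sumℚ-tabulate : ∀ {n} (f : Fin n → ℚ) → sumℚ (tabulate f) ≡ sumQ f
sumℚ-tabulate {zero}  f = refl
sumℚ-tabulate {suc n} f = cong (f zero ℚ.+_) (sumℚ-tabulate (f ∘ suc))

sum²-distrib : ∀ {n} (f g : Fin n → Fin n → ℚ) → sumQ (λ i → sumQ λ j → f i j ℚ.+ g i j) ≡
  sumQ (λ i → sumQ (f i)) ℚ.+ sumQ (λ i → sumQ (g i))
sum²-distrib {n} f g = trans (sumQ-cong λ i → sumQ-distrib {n} (f i) (g i))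
  (sumQ-distrib {n} (λ i → sumQ (f i)) (λ i → sumQ (g i)))

-- The test is the one in `simple`, so `simple T i` tabulates `δ i` by definition.
δ : ∀ {n} → Fin n → Fin n → ℤ
δ i j = if toℕ i ℕ.≡ᵇ toℕ j then + 1 else + 0

sum-0 : ∀ {n} {f : Fin n → ℤ} → (∀ i → f i ≡ + 0) → sum f ≡ + 0
sum-0 {n} eq = trans (sum-cong-≗ eq) (sum-replicate-zero n)

sum-δ : ∀ {n} (f : Fin n → ℤ) i → sum (λ j → f j * δ i j) ≡ f i
sum-δ {suc n} f zero = begin
  f zero * + 1 + sum (λ j → f (suc j) * + 0)  ≡⟨ cong (_+_ (f zero * + 1)) (sum-0 (ℤP.*-zeroʳ ∘ f ∘ suc)) ⟩
  f zero * + 1 + + 0                          ≡⟨ ℤP.+-identityʳ _ ⟩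
  f zero * + 1                                ≡⟨ ℤP.*-identityʳ _ ⟩
  f zero                                      ∎
sum-δ {suc n} f (suc i) = begin
  f zero * + 0 + sum (λ j → f (suc j) * δ i j)  ≡⟨ cong₂ _+_ (ℤP.*-zeroʳ (f zero)) (sum-δ (f ∘ suc) i) ⟩
  + 0 + f (suc i)                               ≡⟨ ℤP.+-identityˡ _ ⟩
  f (suc i)                                     ∎

sum-linear : ∀ {n} (f : Fin n → ℤ) s (g : Fin n → ℤ) → sum (λ i → f i + s * g i) ≡ sum f + s * sum g
sum-linear {n} f s g = trans (∑-distrib-+ {n} f (λ i → s * g i)) (cong (_+_ (sum f)) (sym (*-distribˡ-sum {n} s g)))

module Bilinear {n} (C : Fin n → Fin n → ℤ) where

  -- Bracketed as in `Hyp`, so that the two sums agree term by term on integer vectors.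
  ⟪_,_⟫ : (Fin n → ℤ) → (Fin n → ℤ) → ℤ
  ⟪ f , g ⟫ = sum λ i → sum λ j → (f i * C i j) * g j

  ⟪⟫-cong : ∀ {f f' g g'} → f ≗ f' → g ≗ g' → ⟪ f , g ⟫ ≡ ⟪ f' , g' ⟫
  ⟪⟫-cong p q = sum-cong-≗ λ i → sum-cong-≗ λ j → cong₂ _*_ (cong (_* C i j) (p i)) (q j)

  ⟪⟫-linearˡ : ∀ f s g h → ⟪ (λ i → f i + s * g i) , h ⟫ ≡ ⟪ f , h ⟫ + s * ⟪ g , h ⟫
  ⟪⟫-linearˡ f s g h = begin
    ⟪ (λ i → f i + s * g i) , h ⟫
      ≡⟨ sum-cong-≗ (λ i → trans (sum-cong-≗ λ j → expand (f i) s (g i) (C i j) (h j))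
           (sum-linear (λ j → (f i * C i j) * h j) s (λ j → (g i * C i j) * h j))) ⟩
    sum (λ i → sum (λ j → (f i * C i j) * h j) + s * sum (λ j → (g i * C i j) * h j))
      ≡⟨ sum-linear (λ i → sum λ j → (f i * C i j) * h j) s (λ i → sum λ j → (g i * C i j) * h j) ⟩
    ⟪ f , h ⟫ + s * ⟪ g , h ⟫ ∎
    where
    expand : ∀ a s b c d → ((a + s * b) * c) * d ≡ (a * c) * d + s * ((b * c) * d)
    expand = solve-∀

  ⟪⟫-δʳ : ∀ f i → ⟪ f , δ i ⟫ ≡ sum (λ j → f j * C j i)
  ⟪⟫-δʳ f i = sum-cong-≗ λ j → sum-δ (λ k → f j * C j k) i

  module Symmetric (C-sym : ∀ i j → C i j ≡ C j i) where

    ⟪⟫-sym : ∀ f g → ⟪ f , g ⟫ ≡ ⟪ g , f ⟫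
    ⟪⟫-sym f g = trans (∑-comm {n} {n} λ i j → (f i * C i j) * g j) (sum-cong-≗ λ j → sum-cong-≗ λ i →
      trans (cong (λ c → (f i * c) * g j) (C-sym i j)) (shuffle (f i) (C j i) (g j)))
      where
      shuffle : ∀ a c b → (a * c) * b ≡ (b * c) * a
      shuffle = solve-∀

    ⟪⟫-linearʳ : ∀ f s g h → ⟪ h , (λ i → f i + s * g i) ⟫ ≡ ⟪ h , f ⟫ + s * ⟪ h , g ⟫
    ⟪⟫-linearʳ f s g h = trans (⟪⟫-sym h _) (trans (⟪⟫-linearˡ f s g h)
      (cong₂ (λ x y → x + s * y) (⟪⟫-sym f h) (⟪⟫-sym g h)))

    ⟪⟫-square : ∀ f s g → ⟪ (λ i → f i + s * g i) , (λ i → f i + s * g i) ⟫ ≡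
                ⟪ f , f ⟫ + s * ((+ 2) * ⟪ f , g ⟫ + s * ⟪ g , g ⟫)
    ⟪⟫-square f s g = begin
      ⟪ (λ i → f i + s * g i) , (λ i → f i + s * g i) ⟫ ≡⟨ ⟪⟫-linearˡ f s g _ ⟩
      ⟪ f , _ ⟫ + s * ⟪ g , _ ⟫
        ≡⟨ cong₂ (λ x y → x + s * y) (⟪⟫-linearʳ f s g f) (⟪⟫-linearʳ f s g g) ⟩
      (⟪ f , f ⟫ + s * ⟪ f , g ⟫) + s * (⟪ g , f ⟫ + s * ⟪ g , g ⟫)
        ≡⟨ cong (λ x → (⟪ f , f ⟫ + s * ⟪ f , g ⟫) + s * (x + s * ⟪ g , g ⟫)) (⟪⟫-sym g f) ⟩
      (⟪ f , f ⟫ + s * ⟪ f , g ⟫) + s * (⟪ f , g ⟫ + s * ⟪ g , g ⟫)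
        ≡⟨ collect s ⟪ f , f ⟫ ⟪ f , g ⟫ ⟪ g , g ⟫ ⟩
      ⟪ f , f ⟫ + s * ((+ 2) * ⟪ f , g ⟫ + s * ⟪ g , g ⟫) ∎
      where
      collect : ∀ s x y z → (x + s * y) + s * (y + s * z) ≡ x + s * ((+ 2) * y + s * z)
      collect = solve-∀

TwoZero : ℤ → ℤ → Set
TwoZero m n = (m ≡ + 2 ⊎ m ≡ - (+ 2)) × n ≡ + 0

abs≡2 : ∀ m → ∣ m ∣ ≡ 2 → m ≡ + 2 ⊎ m ≡ - (+ 2)
abs≡2 (+ 2)    refl = inj₁ refl
abs≡2 -[1+ 1 ] refl = inj₂ refl

-- Both absolute values are at most 2, since 3 · 3 already exceeds 4; finitely many cases remain.
sum-of-two-squares≡4 : ∀ m n → m * m + n * n ≡ + 4 → TwoZero m n ⊎ TwoZero n m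
sum-of-two-squares≡4 m n eq with solve ∣ m ∣ ∣ n ∣ abs-eq
  where
  square : ∀ k → k * k ≡ + (∣ k ∣ ℕ.* ∣ k ∣)
  square (+ k)    = sym (ℤP.pos-* k k)
  square -[1+ k ] = refl

  abs-eq : ∣ m ∣ ℕ.* ∣ m ∣ ℕ.+ ∣ n ∣ ℕ.* ∣ n ∣ ≡ 4
  abs-eq = ℤP.+-injective (trans (cong₂ _+_ (sym (square m)) (sym (square n))) eq)

  too-big : ∀ k r → (3 ℕ.+ k) ℕ.* (3 ℕ.+ k) ℕ.+ r ≢ 4
  too-big k r e = ℕP.<⇒≱ {4} {9} (ℕP.m≤m+n 5 4) (subst (9 ℕ.≤_) e
    (ℕP.≤-trans (ℕP.*-mono-≤ (ℕP.m≤m+n 3 k) (ℕP.m≤m+n 3 k)) (ℕP.m≤m+n _ r)))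

  solve : ∀ a b → a ℕ.* a ℕ.+ b ℕ.* b ≡ 4 → (a ≡ 2 × b ≡ 0) ⊎ (b ≡ 2 × a ≡ 0)
  solve 2 0 refl = inj₁ (refl , refl)
  solve 0 2 refl = inj₂ (refl , refl)
  solve (suc (suc (suc k))) b e = ⊥-elim (too-big k _ e)
  solve a (suc (suc (suc k))) e = ⊥-elim (too-big k _ (trans (ℕP.+-comm ((3 ℕ.+ k) ℕ.* (3 ℕ.+ k)) (a ℕ.* a)) e))
  solve 0 0 ()
  solve 0 1 ()
  solve 1 0 ()
  solve 1 1 ()
  solve 1 2 ()
  solve 2 1 ()
  solve 2 2 ()
... | inj₁ (∣m∣≡2 , ∣n∣≡0) = inj₁ (abs≡2 m ∣m∣≡2 , ℤP.∣i∣≡0⇒i≡0 ∣n∣≡0)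
... | inj₂ (∣n∣≡2 , ∣m∣≡0) = inj₂ (abs≡2 n ∣n∣≡2 , ℤP.∣i∣≡0⇒i≡0 ∣m∣≡0)

-- Nondegeneracy of the Cartan matrices

any-cong : ∀ {A : Set} {f g : A → Bool} → f ≗ g → ∀ xs → any f xs ≡ any g xs
any-cong eq []       = refl
any-cong eq (x ∷ xs) = cong₂ _∨_ (eq x) (any-cong eq xs)

any-false : ∀ {A : Set} {f : A → Bool} → (∀ x → f x ≡ false) → ∀ xs → any f xs ≡ false
any-false eq []       = refl
any-false eq (x ∷ xs) rewrite eq x = any-false eq xs

-- `chain` grows at its upper end, while the induction on `D k` removes vertex 0; this splits off
-- the edge `(0 , 1)` and shifts the others.
any-chain-suc : ∀ f m → any f (chain (suc m)) ≡ any (λ (x , y) → f (suc x , suc y)) (chain m) ∨ f (0 , 1)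
any-chain-suc f zero    = BP.∨-comm (f (0 , 1)) false
any-chain-suc f (suc m) = trans (cong (f (suc m , suc (suc m)) ∨_) (any-chain-suc f m))
  (sym (BP.∨-assoc (f (suc m , suc (suc m))) _ _))

≡ᵇ-comm : ∀ m n → (m ℕ.≡ᵇ n) ≡ (n ℕ.≡ᵇ m)
≡ᵇ-comm zero    zero    = refl
≡ᵇ-comm zero    (suc n) = refl
≡ᵇ-comm (suc m) zero    = refl
≡ᵇ-comm (suc m) (suc n) = ≡ᵇ-comm m n

joins : ℕ → ℕ → ℕ × ℕ → Bool
joins a b (x , y) = ((x ℕ.≡ᵇ a) ∧ (y ℕ.≡ᵇ b)) ∨ ((x ℕ.≡ᵇ b) ∧ (y ℕ.≡ᵇ a))

adjacent-joins : ∀ T a b → adjacent T a b ≡ any (joins a b) (edges T)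
adjacent-joins T a b = any-cong (λ _ → refl) (edges T)

adjacent-sym : ∀ T a b → adjacent T a b ≡ adjacent T b a
adjacent-sym T a b = any-cong (λ (x , y) → BP.∨-comm ((x ℕ.≡ᵇ a) ∧ (y ℕ.≡ᵇ b)) _) (edges T)

cartan-sym : ∀ T i j → cartan T i j ≡ cartan T j i
cartan-sym T i j rewrite ≡ᵇ-comm (toℕ i) (toℕ j) | adjacent-sym T (toℕ i) (toℕ j) = refl

adjacent-D-suc : ∀ k a b → adjacent (D (suc k)) (suc a) (suc b) ≡ adjacent (D k) a b
adjacent-D-suc k a b = trans (adjacent-joins (D (suc k)) (suc a) (suc b)) (trans
  (cong (joins a b (k ℕ.+ 1 , k ℕ.+ 3) ∨_)
    (trans (any-chain-suc (joins (suc a) (suc b)) (k ℕ.+ 2)) (BP.∨-identityʳ _)))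
  (sym (adjacent-joins (D k) a b)))

cartan-D-suc : ∀ k i j → cartan (D (suc k)) (suc i) (suc j) ≡ cartan (D k) i j
cartan-D-suc k i j rewrite adjacent-D-suc k (toℕ i) (toℕ j) = refl

adjacent-D-zero : ∀ k b → adjacent (D (suc k)) 0 (suc b) ≡ (0 ℕ.≡ᵇ b)
adjacent-D-zero k b = trans (adjacent-joins (D (suc k)) 0 (suc b)) (trans
  (cong₂ _∨_ (BP.∧-zeroʳ (k ℕ.+ 1 ℕ.≡ᵇ b)) (any-chain-suc (joins 0 (suc b)) (k ℕ.+ 2)))
  (trans (cong (_∨ joins 0 (suc b) (0 , 1)) (any-false (λ (x , _) → BP.∧-zeroʳ (x ℕ.≡ᵇ b)) (chain (k ℕ.+ 2))))
    (BP.∨-identityʳ _)))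

-- Vertices 0 and 1. Since `k + 4` does not reduce for a variable `k`, both need a case split.
tip next-to-tip : ∀ k → Fin (k ℕ.+ 4)
tip zero     = zero
tip (suc k)  = zero
next-to-tip zero    = suc zero
next-to-tip (suc k) = suc (tip k)

toℕ-tip : ∀ k → toℕ (tip k) ≡ 0
toℕ-tip zero    = refl
toℕ-tip (suc k) = refl

δ-tip : ∀ k j → δ (tip k) j ≡ (if 0 ℕ.≡ᵇ toℕ j then + 1 else + 0)
δ-tip k j rewrite toℕ-tip k = refl

cartan-D-zero : ∀ k j → cartan (D (suc k)) zero (suc j) ≡ - δ (tip k) j
cartan-D-zero k j rewrite adjacent-D-zero k (toℕ j) | δ-tip k j with 0 ℕ.≡ᵇ toℕ j
... | true  = refl
... | false = refl

Nondegenerate : ∀ {n} → (Fin n → Fin n → ℤ) → Set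
Nondegenerate {n} C = ∀ (w : Fin n → ℤ) → (∀ j → sum (λ i → w i * C i j) ≡ + 0) → ∀ i → w i ≡ + 0

column : ∀ k → (Fin (k ℕ.+ 4) → ℤ) → Fin (k ℕ.+ 4) → ℤ
column k w j = sum (λ i → w i * cartan (D k) i j)

column-suc : ∀ k w j → column (suc k) w (suc j) ≡ w zero * - δ (tip k) j + column k (w ∘ suc) j
column-suc k w j = cong₂ _+_ (cong (w zero *_) (cartan-D-zero k j))
  (sum-cong-≗ λ i → cong (w (suc i) *_) (cartan-D-suc k i j))

column-tip : ∀ k w → column k w (tip k) ≡ + 2 * w (tip k) + - w (next-to-tip k)
column-tip zero w = lemma (w zero) (w (suc zero)) (w (suc (suc zero))) (w (suc (suc (suc zero))))
  where
  lemma : ∀ a b c d → a * + 2 + (b * -[1+ 0 ] + (c * + 0 + (d * + 0 + + 0))) ≡ + 2 * a + - b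
  lemma = solve-∀
column-tip (suc k) w = begin
  w zero * + 2 + sum (λ i → w (suc i) * cartan (D (suc k)) (suc i) zero)
    ≡⟨ cong (_+_ (w zero * + 2)) (sum-cong-≗ λ i → trans
         (cong (w (suc i) *_) (trans (cartan-sym (D (suc k)) (suc i) zero) (cartan-D-zero k i)))
         (move (w (suc i)) (δ (tip k) i))) ⟩
  w zero * + 2 + sum (λ i → - w (suc i) * δ (tip k) i)
    ≡⟨ cong₂ _+_ (ℤP.*-comm (w zero) (+ 2)) (sum-δ (λ i → - w (suc i)) (tip k)) ⟩
  + 2 * w zero + - w (suc (tip k)) ∎
  where
  move : ∀ a b → a * - b ≡ - a * b
  move = solve-∀

-- The equations away from the tip force the weights to be constant
-- along the chain; the first one then determines all of them.
tail-constant : ∀ k w → (∀ j → j ≢ tip k → column k w j ≡ + 0) →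
  w (tip k) ≡ w (next-to-tip k) × (w (tip k) ≡ + 0 → ∀ i → w i ≡ + 0)
tail-constant zero w eqs = a≡b , vanish
  where
  a b c d : ℤ
  a = w zero
  b = w (suc zero)
  c = w (suc (suc zero))
  d = w (suc (suc (suc zero)))

  double-c : + 2 * c ≡ b
  double-c = ℤP.i-j≡0⇒i≡j _ _ (trans (lemma a b c d) (eqs (suc (suc zero)) λ ()))
    where
    lemma : ∀ a b c d → + 2 * c ℤ.- b ≡ a * + 0 + (b * -[1+ 0 ] + (c * + 2 + (d * + 0 + + 0)))
    lemma = solve-∀

  double-d : + 2 * d ≡ b
  double-d = ℤP.i-j≡0⇒i≡j _ _ (trans (lemma a b c d) (eqs (suc (suc (suc zero))) λ ()))
    where
    lemma : ∀ a b c d → + 2 * d ℤ.- b ≡ a * + 0 + (b * -[1+ 0 ] + (c * + 0 + (d * + 2 + + 0)))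
    lemma = solve-∀

  -- Twice the branch equation `2b = a + c + d`, combined with the two leaf equations, eliminates
  -- `c` and `d`.
  a≡b : a ≡ b
  a≡b = ℤP.*-cancelˡ-≡ (+ 2) a b $ ℤP.i-j≡0⇒i≡j _ _ $ begin
    + 2 * a ℤ.- + 2 * b
      ≡⟨ lemma a b c d ⟩
    -[1+ 1 ] * (a * -[1+ 0 ] + (b * + 2 + (c * -[1+ 0 ] + (d * -[1+ 0 ] + + 0))))
      + ((b ℤ.- + 2 * c) + (b ℤ.- + 2 * d))
      ≡⟨ cong₂ _+_ (cong (_*_ -[1+ 1 ]) (eqs (suc zero) λ ()))
           (cong₂ _+_ (ℤP.i≡j⇒i-j≡0 (sym double-c)) (ℤP.i≡j⇒i-j≡0 (sym double-d))) ⟩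
    + 0 ∎
    where
    lemma : ∀ a b c d → + 2 * a ℤ.- + 2 * b ≡
      -[1+ 1 ] * (a * -[1+ 0 ] + (b * + 2 + (c * -[1+ 0 ] + (d * -[1+ 0 ] + + 0))))
        + ((b ℤ.- + 2 * c) + (b ℤ.- + 2 * d))
    lemma = solve-∀

  vanish : a ≡ + 0 → ∀ i → w i ≡ + 0
  vanish a≡0 zero = a≡0
  vanish a≡0 (suc zero) = trans (sym a≡b) a≡0
  vanish a≡0 (suc (suc zero)) = ℤP.*-cancelˡ-≡ (+ 2) c (+ 0) (trans double-c (trans (sym a≡b) a≡0))
  vanish a≡0 (suc (suc (suc zero))) = ℤP.*-cancelˡ-≡ (+ 2) d (+ 0) (trans double-d (trans (sym a≡b) a≡0))
tail-constant (suc k) w eqs with tail-constant k (w ∘ suc) eqs′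
  where
  -- The new vertex is adjacent only to the old tip, so all other columns are those of `D k`.
  eqs′ : ∀ j → j ≢ tip k → column k (w ∘ suc) j ≡ + 0
  eqs′ j j≢ = begin
    column k (w ∘ suc) j                                ≡⟨ ℤP.+-identityˡ _ ⟨
    + 0 + column k (w ∘ suc) j                          ≡⟨ cong (λ z → z + column k (w ∘ suc) j) off-diagonal ⟨
    w zero * - δ (tip k) j + column k (w ∘ suc) j       ≡⟨ column-suc k w j ⟨
    column (suc k) w (suc j)                            ≡⟨ eqs (suc j) (λ ()) ⟩
    + 0                                                 ∎
    where
    δ≡0 : δ (tip k) j ≡ + 0
    δ≡0 rewrite δ-tip k j with toℕ j in eq
    ... | zero  = contradiction (FP.toℕ-injective (trans eq (sym (toℕ-tip k)))) j≢
    ... | suc _ = refl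
    off-diagonal : w zero * - δ (tip k) j ≡ + 0
    off-diagonal rewrite δ≡0 = ℤP.*-zeroʳ (w zero)
... | constant , vanish = w₀≡w₁ , λ { w₀≡0 zero → w₀≡0 ; w₀≡0 (suc i) → vanish (trans (sym w₀≡w₁) w₀≡0) i }
  where
  x y : ℤ
  x = w (suc (tip k))
  y = w (suc (next-to-tip k))
  w₀≡w₁ : w zero ≡ x
  -- The equation at the old tip is `2x - y = w zero`, and `x = y` by induction.
  w₀≡w₁ = sym $ ℤP.i-j≡0⇒i≡j _ _ $ begin
    x ℤ.- w zero
      ≡⟨ lemma x y (w zero) ⟩
    (y ℤ.- x) + (w zero * - (+ 1) + (+ 2 * x + - y))
      ≡⟨ cong₂ _+_ (ℤP.i≡j⇒i-j≡0 (sym constant)) (cong₂ _+_ (cong (λ d → w zero * - d) (sym (δ-refl k)))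
           (sym (column-tip k (w ∘ suc)))) ⟩
    + 0 + (w zero * - δ (tip k) (tip k) + column k (w ∘ suc) (tip k))
      ≡⟨ trans (ℤP.+-identityˡ _) (trans (sym (column-suc k w (tip k))) (eqs (suc (tip k)) λ ())) ⟩
    + 0 ∎
    where
    δ-refl : ∀ k → δ (tip k) (tip k) ≡ + 1
    δ-refl k rewrite toℕ-tip k = refl
    lemma : ∀ x y z → x ℤ.- z ≡ (y ℤ.- x) + (z * - (+ 1) + (+ 2 * x + - y))
    lemma = solve-∀

-- The equation at the tip, set aside in `tail-constant`, reads `2x = y`; together with `x = y` it
-- gives `x = 0`.
nondegenerate-D : ∀ k → Nondegenerate (cartan (D k))
nondegenerate-D k w eqs with tail-constant k w (λ j _ → eqs j)
... | constant , vanish = vanish $ begin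
  x                              ≡⟨ lemma x y ⟩
  (y ℤ.- x) + (+ 2 * x + - y)    ≡⟨ cong₂ _+_ (ℤP.i≡j⇒i-j≡0 (sym constant)) (trans (sym (column-tip k w)) (eqs (tip k))) ⟩
  + 0                            ∎
  where
  x y : ℤ
  x = w (tip k)
  y = w (next-to-tip k)
  lemma : ∀ x y → x ≡ (y ℤ.- x) + (+ 2 * x + - y)
  lemma = solve-∀

-- Types E by explicit inverse matrices

ScaledInverse : ∀ {n} → (Fin n → Fin n → ℤ) → Vec (Vec ℕ n) n → ℤ → Set
ScaledInverse C rows d = ∀ i l → sum (λ j → C i j * + lookup (lookup rows j) l) ≡ d * δ l i

scaledInverse? : ∀ {n} (C : Fin n → Fin n → ℤ) rows d → Dec (ScaledInverse C rows d)
scaledInverse? C rows d = FP.all? λ i → FP.all? λ l → _ ℤ.≟ _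

-- Multiplying `w C = 0` on the right by the integer matrix `rows` gives `d w = 0`.
scaledInverse⇒nondegenerate : ∀ {n} (C : Fin n → Fin n → ℤ) rows d .{{_ : ℤ.NonZero d}} →
  ScaledInverse C rows d → Nondegenerate C
scaledInverse⇒nondegenerate {n} C rows d inverse w eqs l = ℤP.*-cancelˡ-≡ d (w l) (+ 0) $ begin
  d * w l
    ≡⟨ cong (d *_) (sum-δ w l) ⟨
  d * sum (λ i → w i * δ l i)
    ≡⟨ *-distribˡ-sum {n} d (λ i → w i * δ l i) ⟩
  sum (λ i → d * (w i * δ l i))
    ≡⟨ sum-cong-≗ (λ i → trans (swap-left d (w i) (δ l i)) (cong (w i *_) (sym (inverse i l)))) ⟩
  sum (λ i → w i * sum (λ j → C i j * K j l))
    ≡⟨ sum-cong-≗ (λ i → trans (*-distribˡ-sum {n} (w i) (λ j → C i j * K j l))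
         (sum-cong-≗ λ j → sym (ℤP.*-assoc (w i) (C i j) (K j l)))) ⟩
  sum (λ i → sum (λ j → w i * C i j * K j l))
    ≡⟨ ∑-comm {n} {n} (λ i j → w i * C i j * K j l) ⟩
  sum (λ j → sum (λ i → w i * C i j * K j l))
    ≡⟨ sum-0 (λ j → trans (sym (*-distribʳ-sum {n} (K j l) (λ i → w i * C i j))) (cong (_* K j l) (eqs j))) ⟩
  + 0
    ≡⟨ ℤP.*-zeroʳ d ⟨
  d * + 0 ∎
  where
  K : Fin n → Fin n → ℤ
  K j l = + lookup (lookup rows j) l
  swap-left : ∀ a b c → a * (b * c) ≡ b * (a * c)
  swap-left = solve-∀

-- Scaled by the determinants 3, 2 and 1.
inverse-E6 : Vec (Vec ℕ 6) 6
inverse-E6 =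
  (4 ∷ 3 ∷ 5 ∷ 6 ∷ 4 ∷ 2 ∷ []) ∷
    (3 ∷ 6 ∷ 6 ∷ 9 ∷ 6 ∷ 3 ∷ []) ∷
    (5 ∷ 6 ∷ 10 ∷ 12 ∷ 8 ∷ 4 ∷ []) ∷
    (6 ∷ 9 ∷ 12 ∷ 18 ∷ 12 ∷ 6 ∷ []) ∷
    (4 ∷ 6 ∷ 8 ∷ 12 ∷ 10 ∷ 5 ∷ []) ∷
    (2 ∷ 3 ∷ 4 ∷ 6 ∷ 5 ∷ 4 ∷ []) ∷ []

inverse-E7 : Vec (Vec ℕ 7) 7
inverse-E7 =
  (4 ∷ 4 ∷ 6 ∷ 8 ∷ 6 ∷ 4 ∷ 2 ∷ []) ∷
    (4 ∷ 7 ∷ 8 ∷ 12 ∷ 9 ∷ 6 ∷ 3 ∷ []) ∷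
    (6 ∷ 8 ∷ 12 ∷ 16 ∷ 12 ∷ 8 ∷ 4 ∷ []) ∷
    (8 ∷ 12 ∷ 16 ∷ 24 ∷ 18 ∷ 12 ∷ 6 ∷ []) ∷
    (6 ∷ 9 ∷ 12 ∷ 18 ∷ 15 ∷ 10 ∷ 5 ∷ []) ∷
    (4 ∷ 6 ∷ 8 ∷ 12 ∷ 10 ∷ 8 ∷ 4 ∷ []) ∷
    (2 ∷ 3 ∷ 4 ∷ 6 ∷ 5 ∷ 4 ∷ 3 ∷ []) ∷ []

inverse-E8 : Vec (Vec ℕ 8) 8
inverse-E8 =
  (4 ∷ 5 ∷ 7 ∷ 10 ∷ 8 ∷ 6 ∷ 4 ∷ 2 ∷ []) ∷
    (5 ∷ 8 ∷ 10 ∷ 15 ∷ 12 ∷ 9 ∷ 6 ∷ 3 ∷ []) ∷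
    (7 ∷ 10 ∷ 14 ∷ 20 ∷ 16 ∷ 12 ∷ 8 ∷ 4 ∷ []) ∷
    (10 ∷ 15 ∷ 20 ∷ 30 ∷ 24 ∷ 18 ∷ 12 ∷ 6 ∷ []) ∷
    (8 ∷ 12 ∷ 16 ∷ 24 ∷ 20 ∷ 15 ∷ 10 ∷ 5 ∷ []) ∷
    (6 ∷ 9 ∷ 12 ∷ 18 ∷ 15 ∷ 12 ∷ 8 ∷ 4 ∷ []) ∷
    (4 ∷ 6 ∷ 8 ∷ 12 ∷ 10 ∷ 8 ∷ 6 ∷ 3 ∷ []) ∷
    (2 ∷ 3 ∷ 4 ∷ 6 ∷ 5 ∷ 4 ∷ 3 ∷ 2 ∷ []) ∷ []

nondegenerate : ∀ T → Nondegenerate (cartan T)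
nondegenerate (D k) = nondegenerate-D k
nondegenerate E6 = scaledInverse⇒nondegenerate (cartan E6) inverse-E6 (+ 3)
  (from-yes (scaledInverse? (cartan E6) inverse-E6 (+ 3)))
nondegenerate E7 = scaledInverse⇒nondegenerate (cartan E7) inverse-E7 (+ 2)
  (from-yes (scaledInverse? (cartan E7) inverse-E7 (+ 2)))
nondegenerate E8 = scaledInverse⇒nondegenerate (cartan E8) inverse-E8 (+ 1)
  (from-yes (scaledInverse? (cartan E8) inverse-E8 (+ 1)))

-- Roots and their hyperplanes

-- `z / 1` is normalised through a gcd that does not reduce for a variable `z`; from the explicit
-- form sums and products compute.
toℚ-mkℚ : ∀ z → toℚ z ≡ mkℚ z 0 (Coprime.sym (Coprime.1-coprimeTo ∣ z ∣))
toℚ-mkℚ z = ℚP.↥p/↧p≡p (mkℚ z 0 _)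

toℚ-+ : ∀ x y → toℚ (x + y) ≡ toℚ x ℚ.+ toℚ y
toℚ-+ x y = trans (cong toℚ (cong₂ _+_ (sym (ℤP.*-identityʳ x)) (sym (ℤP.*-identityʳ y))))
  (sym (cong₂ ℚ._+_ (toℚ-mkℚ x) (toℚ-mkℚ y)))

toℚ-* : ∀ x y → toℚ (x * y) ≡ toℚ x ℚ.* toℚ y
toℚ-* x y = sym (cong₂ ℚ._*_ (toℚ-mkℚ x) (toℚ-mkℚ y))

toℚ≡0⇒≡0 : ∀ z → toℚ z ≡ 0ℚ → z ≡ + 0
toℚ≡0⇒≡0 z eq = cong ℚ.ℚ.numerator (trans (sym (toℚ-mkℚ z)) eq)

toℚ-sum : ∀ {n} (f : Fin n → ℤ) → toℚ (sum f) ≡ sumQ (toℚ ∘ f)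
toℚ-sum {zero}  f = refl
toℚ-sum {suc n} f = trans (toℚ-+ (f zero) (sum (f ∘ suc))) (cong (ℚ._+_ (toℚ (f zero))) (toℚ-sum (f ∘ suc)))

fromℤ : ∀ {n} → (Fin n → ℤ) → VecQ n
fromℤ f = tabulate (toℚ ∘ f)

nonneg∧≡-⇒≡ : ∀ {x y} → + 0 ℤ.≤ x → + 0 ℤ.≤ y → x ≡ - y → x ≡ y
nonneg∧≡-⇒≡ {y = + zero} _ _ eq = eq
nonneg∧≡-⇒≡ {y = + suc _} () _ refl

module RootSystem (T : ADE) where

  open Bilinear (cartan T) public
  open Symmetric (cartan-sym T) public

  lookup-simple : ∀ i j → lookup (simple T i) j ≡ δ i j
  lookup-simple i = VP.lookup∘tabulate (δ i)

  lookup-addC : ∀ x y j → lookup (addC T x y) j ≡ lookup x j + lookup y j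
  lookup-addC x y j = VP.lookup-zipWith _+_ j x y

  pairing≡⟪⟫ : ∀ x i → pairing T x i ≡ ⟪ lookup x , δ i ⟫
  pairing≡⟪⟫ x i = trans (sumℤ-tabulate λ j → lookup x j * cartan T j i) (sym (⟪⟫-δʳ (lookup x) i))

  ⟪δ,δ⟫ : ∀ i j → ⟪ δ i , δ j ⟫ ≡ cartan T i j
  ⟪δ,δ⟫ i j = trans (⟪⟫-δʳ (δ i) j)
    (trans (sum-cong-≗ λ k → ℤP.*-comm (δ i k) (cartan T k j)) (sum-δ (λ k → cartan T k j) i))

  ⟪⟫-addCˡ : ∀ x y h → ⟪ lookup (addC T x y) , h ⟫ ≡ ⟪ lookup x , h ⟫ + ⟪ lookup y , h ⟫
  ⟪⟫-addCˡ x y h = trans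
    (⟪⟫-cong {g = h}
      (λ j → trans (lookup-addC x y j) (cong (_+_ (lookup x j)) (sym (ℤP.*-identityˡ (lookup y j)))))
      (λ _ → refl))
    (trans (⟪⟫-linearˡ (lookup x) (+ 1) (lookup y) h) (cong (_+_ ⟪ lookup x , h ⟫) (ℤP.*-identityˡ _)))

  -- The reflection adds `- p` times a root of norm 2, where `p` is the pairing, so the cross term
  -- `- 2 p p` cancels the square term `2 p p`.
  root-norm : ∀ {x} → Root T x → ⟪ lookup x , lookup x ⟫ ≡ + 2
  root-norm (simpleRoot i) = trans (⟪⟫-cong (lookup-simple i) (lookup-simple i)) (trans (⟪δ,δ⟫ i i) diagonal)
    where
    diagonal : cartan T i i ≡ + 2
    diagonal with toℕ i ℕ.≡ᵇ toℕ i | ℕP.≡⇒≡ᵇ (toℕ i) (toℕ i) refl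
    ... | true | _ = refl
  root-norm (reflRoot i {x} r) = begin
    ⟪ lookup (reflect T i x) , lookup (reflect T i x) ⟫
      ≡⟨ ⟪⟫-cong reflected reflected ⟩
    ⟪ (λ j → lookup x j + - p * δ i j) , (λ j → lookup x j + - p * δ i j) ⟫
      ≡⟨ ⟪⟫-square (lookup x) (- p) (δ i) ⟩
    ⟪ lookup x , lookup x ⟫ + - p * (+ 2 * ⟪ lookup x , δ i ⟫ + - p * ⟪ δ i , δ i ⟫)
      ≡⟨ cong₂ (λ s t → ⟪ lookup x , lookup x ⟫ + - p * (+ 2 * s + - p * t)) (sym (pairing≡⟪⟫ x i)) norm-δ ⟩
    ⟪ lookup x , lookup x ⟫ + - p * (+ 2 * p + - p * + 2)
      ≡⟨ cancel ⟪ lookup x , lookup x ⟫ p ⟩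
    ⟪ lookup x , lookup x ⟫
      ≡⟨ root-norm r ⟩
    + 2 ∎
    where
    p : ℤ
    p = pairing T x i
    norm-δ : ⟪ δ i , δ i ⟫ ≡ + 2
    norm-δ = trans (⟪⟫-cong (sym ∘ lookup-simple i) (sym ∘ lookup-simple i)) (root-norm (simpleRoot i))
    expand : ∀ a p d → a ℤ.- p * d ≡ a + - p * d
    expand = solve-∀
    reflected : ∀ j → lookup (reflect T i x) j ≡ lookup x j + - p * δ i j
    reflected j = trans (VP.lookup∘tabulate _ j)
      (trans (expand (lookup x j) p (lookup (simple T i) j)) (cong (λ d → lookup x j + - p * d) (lookup-simple i j)))
    cancel : ∀ a p → a + - p * (+ 2 * p + - p * + 2) ≡ a
    cancel = solve-∀

  functional : Coord T → VecQ (rank T) → ℚ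
  functional α v = sumQ λ i → sumQ λ j → toℚ (lookup α i * cartan T i j) ℚ.* lookup v j

  functional≡ : ∀ α v →
    sumℚ (tabulate λ i → sumℚ (tabulate λ j → toℚ (lookup α i * cartan T i j) ℚ.* lookup v j)) ≡ functional α v
  functional≡ α v = trans (sumℚ-tabulate λ i → sumℚ (tabulate λ j → toℚ (lookup α i * cartan T i j) ℚ.* lookup v j))
    (sumQ-cong λ i → sumℚ-tabulate λ j → toℚ (lookup α i * cartan T i j) ℚ.* lookup v j)

  Hyp⇒functional : ∀ α v → Hyp T α v → functional α v ≡ 0ℚ
  Hyp⇒functional α v = trans (sym (functional≡ α v))

  functional⇒Hyp : ∀ α v → functional α v ≡ 0ℚ → Hyp T α v
  functional⇒Hyp α v = trans (functional≡ α v)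

  functional-addC : ∀ α β v → functional (addC T α β) v ≡ functional α v ℚ.+ functional β v
  functional-addC α β v = trans
    (sumQ-cong λ i → sumQ-cong λ j → split i j)
    (sum²-distrib (λ i j → toℚ (lookup α i * cartan T i j) ℚ.* lookup v j)
                  (λ i j → toℚ (lookup β i * cartan T i j) ℚ.* lookup v j))
    where
    split : ∀ i j → toℚ (lookup (addC T α β) i * cartan T i j) ℚ.* lookup v j ≡
      toℚ (lookup α i * cartan T i j) ℚ.* lookup v j ℚ.+ toℚ (lookup β i * cartan T i j) ℚ.* lookup v j
    split i j = trans
      (cong (λ q → q ℚ.* lookup v j) (trans
        (cong toℚ (trans (cong (λ z → z * cartan T i j) (lookup-addC α β i))
          (ℤP.*-distribʳ-+ (cartan T i j) (lookup α i) (lookup β i))))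
        (toℚ-+ (lookup α i * cartan T i j) (lookup β i * cartan T i j))))
      (ℚP.*-distribʳ-+ (lookup v j) (toℚ (lookup α i * cartan T i j)) (toℚ (lookup β i * cartan T i j)))

  functional-⊕ : ∀ α u v → functional α (u ⊕ v) ≡ functional α u ℚ.+ functional α v
  functional-⊕ α u v = trans
    (sumQ-cong λ i → sumQ-cong λ j → trans
      (cong (ℚ._*_ (toℚ (lookup α i * cartan T i j))) (VP.lookup-zipWith ℚ._+_ j u v))
      (ℚP.*-distribˡ-+ (toℚ (lookup α i * cartan T i j)) (lookup u j) (lookup v j)))
    (sum²-distrib (λ i j → toℚ (lookup α i * cartan T i j) ℚ.* lookup u j)
                  (λ i j → toℚ (lookup α i * cartan T i j) ℚ.* lookup v j))

  functional-fromℤ : ∀ α f → functional α (fromℤ f) ≡ toℚ ⟪ lookup α , f ⟫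
  functional-fromℤ α f = sym (trans (toℚ-sum λ i → sum λ j → lookup α i * cartan T i j * f j)
    (sumQ-cong λ i → trans (toℚ-sum λ j → lookup α i * cartan T i j * f j)
      (sumQ-cong λ j → trans (toℚ-* (lookup α i * cartan T i j) (f j))
        (cong (ℚ._*_ (toℚ (lookup α i * cartan T i j))) (sym (VP.lookup∘tabulate (toℚ ∘ f) j))))))

  ⊥⇒Hyp : ∀ α f → ⟪ lookup α , f ⟫ ≡ + 0 → Hyp T α (fromℤ f)
  ⊥⇒Hyp α f eq = functional⇒Hyp α (fromℤ f) (trans (functional-fromℤ α f) (cong toℚ eq))

  Hyp⇒⊥ : ∀ α f → Hyp T α (fromℤ f) → ⟪ lookup α , f ⟫ ≡ + 0
  Hyp⇒⊥ α f h = toℚ≡0⇒≡0 _ (trans (sym (functional-fromℤ α f)) (Hyp⇒functional α (fromℤ f) h))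

  Hyp-linear : ∀ α → IsLinear (Hyp T α)
  Hyp-linear α = record
    { has-0 = functional⇒Hyp α 0ᵛ $ trans
        (sumQ-cong λ i → trans (sumQ-cong λ j → trans
          (cong (ℚ._*_ (toℚ (lookup α i * cartan T i j))) (VP.lookup-replicate j 0ℚ))
          (ℚP.*-zeroʳ (toℚ (lookup α i * cartan T i j)))) (sumQ-zero (rank T)))
        (sumQ-zero (rank T))
    ; +-closed = λ {u} {v} Hu Hv → functional⇒Hyp α (u ⊕ v) $
        trans (functional-⊕ α u v) (cong₂ ℚ._+_ (Hyp⇒functional α u Hu) (Hyp⇒functional α v Hv))
    ; +-cancelʳ = λ {u} {v} Huv Hv → functional⇒Hyp α u $ trans (sym (ℚP.+-identityʳ _))
        (trans (cong (ℚ._+_ (functional α u)) (sym (Hyp⇒functional α v Hv)))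
        (trans (sym (functional-⊕ α u v)) (Hyp⇒functional α (u ⊕ v) Huv)))
    }

  addC-collinear : ∀ α β → Collinear (Hyp T α) (Hyp T β) (Hyp T (addC T α β))
  addC-collinear α β = record
    { meet₁₂ = λ v (Hα , Hβ) → functional⇒Hyp (addC T α β) v (trans (functional-addC α β v)
        (cong₂ ℚ._+_ (Hyp⇒functional α v Hα) (Hyp⇒functional β v Hβ)))
    ; meet₁₃ = λ v (Hα , Hγ) → functional⇒Hyp β v (trans (sym (ℚP.+-identityˡ _))
        (trans (cong (λ q → q ℚ.+ functional β v) (sym (Hyp⇒functional α v Hα)))
        (trans (sym (functional-addC α β v)) (Hyp⇒functional (addC T α β) v Hγ))))
    ; meet₂₃ = λ v (Hβ , Hγ) → functional⇒Hyp α v (trans (sym (ℚP.+-identityʳ _))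
        (trans (cong (ℚ._+_ (functional α v)) (sym (Hyp⇒functional β v Hβ)))
        (trans (sym (functional-addC α β v)) (Hyp⇒functional (addC T α β) v Hγ))))
    }

  orthogonal-roots-distinct : ∀ {a b} → Root T a → ⟪ lookup a , lookup b ⟫ ≡ + 0 → a ≢ b
  orthogonal-roots-distinct r ⊥ab refl with trans (sym (root-norm r)) ⊥ab
  ... | ()

  -- As roots have norm 2, doubling the projection away from two orthogonal roots avoids halves. The
  -- doubling is written as a sum to fit `⟪⟫-linearˡ`.
  doubled-residue : (f a : Fin (rank T) → ℤ) (s : ℤ) (b : Fin (rank T) → ℤ) (t : ℤ) → Fin (rank T) → ℤ
  doubled-residue f a s b t i = ((f i + + 1 * f i) + - s * a i) + - t * b i

  ⟪⟫-residueˡ : ∀ f a s b t h → ⟪ doubled-residue f a s b t , h ⟫ ≡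
    ((⟪ f , h ⟫ + + 1 * ⟪ f , h ⟫) + - s * ⟪ a , h ⟫) + - t * ⟪ b , h ⟫
  ⟪⟫-residueˡ f a s b t h = trans (⟪⟫-linearˡ (λ i → (f i + + 1 * f i) + - s * a i) (- t) b h)
    (cong (λ z → z + - t * ⟪ b , h ⟫) (trans (⟪⟫-linearˡ (λ i → f i + + 1 * f i) (- s) a h)
    (cong (λ z → z + - s * ⟪ a , h ⟫) (⟪⟫-linearˡ f (+ 1) f h))))

  -- Testing the inclusion on the vectors 2 eⱼ - ⟪eⱼ,a⟫ a - ⟪eⱼ,b⟫ b of H a ∩ H b
  -- gives 2 x = ⟪x,a⟫ a + ⟪x,b⟫ b by nondegeneracy; the norms of the roots then
  -- force ⟪x,a⟫² + ⟪x,b⟫² = 4.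
  orthogonal-pair-generic : ∀ {a b x} → Positive T a → Positive T b → Positive T x →
    ⟪ lookup a , lookup b ⟫ ≡ + 0 → (Hyp T a ∩S Hyp T b) ⊆S Hyp T x → x ≡ a ⊎ x ≡ b
  orthogonal-pair-generic {a} {b} {x} (root-a , a≥0) (root-b , b≥0) (root-x , x≥0) a⊥b ⊆x =
    conclude (sum-of-two-squares≡4 m n squares)
    where
    A B X : Fin (rank T) → ℤ
    A = lookup a
    B = lookup b
    X = lookup x
    m n : ℤ
    m = ⟪ A , X ⟫
    n = ⟪ B , X ⟫

    w : Fin (rank T) → ℤ
    w = doubled-residue X A m B n

    -- Taking the residue is self-adjoint: pairing `w` with `δ j` equals pairing `X` with the
    -- residue of `δ j`, which is orthogonal to `a` and `b`.
    w-radical : ∀ j → ⟪ w , δ j ⟫ ≡ + 0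
    w-radical j = begin
      ⟪ w , δ j ⟫
        ≡⟨ ⟪⟫-residueˡ X A m B n (δ j) ⟩
      ((⟪ X , δ j ⟫ + + 1 * ⟪ X , δ j ⟫) + - m * ⟪ A , δ j ⟫) + - n * ⟪ B , δ j ⟫
        ≡⟨ cong (λ z → ((z + + 1 * z) + - m * ⟪ A , δ j ⟫) + - n * ⟪ B , δ j ⟫) (⟪⟫-sym X (δ j)) ⟩
      ((⟪ δ j , X ⟫ + + 1 * ⟪ δ j , X ⟫) + - m * p) + - n * q
        ≡⟨ swap-factors ⟪ δ j , X ⟫ m n p q ⟩
      ((⟪ δ j , X ⟫ + + 1 * ⟪ δ j , X ⟫) + - p * m) + - q * n
        ≡⟨ sym (⟪⟫-residueˡ (δ j) A p B q X) ⟩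
      ⟪ test , X ⟫
        ≡⟨ ⟪⟫-sym test X ⟩
      ⟪ X , test ⟫
        ≡⟨ Hyp⇒⊥ x test (⊆x (fromℤ test) (⊥⇒Hyp a test a⊥test , ⊥⇒Hyp b test b⊥test)) ⟩
      + 0 ∎
      where
      p q : ℤ
      p = ⟪ A , δ j ⟫
      q = ⟪ B , δ j ⟫
      test : Fin (rank T) → ℤ
      test = doubled-residue (δ j) A p B q
      swap-factors : ∀ d m n p q → ((d + + 1 * d) + - m * p) + - n * q ≡ ((d + + 1 * d) + - p * m) + - q * n
      swap-factors = solve-∀
      vanishˡ : ∀ p q → ((p + + 1 * p) + - p * + 2) + - q * + 0 ≡ + 0
      vanishˡ = solve-∀
      vanishʳ : ∀ p q → ((q + + 1 * q) + - p * + 0) + - q * + 2 ≡ + 0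
      vanishʳ = solve-∀
      a⊥test : ⟪ A , test ⟫ ≡ + 0
      a⊥test = trans (⟪⟫-sym A test) (trans (⟪⟫-residueˡ (δ j) A p B q A) (trans
        (cong₂ _+_ (cong₂ (λ y z → (y + + 1 * y) + - p * z) (⟪⟫-sym (δ j) A) (root-norm root-a))
          (cong (λ z → - q * z) (trans (⟪⟫-sym B A) a⊥b))) (vanishˡ p q)))
      b⊥test : ⟪ B , test ⟫ ≡ + 0
      b⊥test = trans (⟪⟫-sym B test) (trans (⟪⟫-residueˡ (δ j) A p B q B) (trans
        (cong₂ _+_ (cong₂ (λ y z → (y + + 1 * y) + - p * z) (⟪⟫-sym (δ j) B) a⊥b)
          (cong (λ z → - q * z) (root-norm root-b))) (vanishʳ p q)))

    w≡0 : ∀ i → w i ≡ + 0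
    w≡0 = nondegenerate T w λ j → trans (sym (⟪⟫-δʳ w j)) (w-radical j)

    squares : m * m + n * n ≡ + 4
    squares = begin
      m * m + n * n
        ≡⟨ rearrange m n ⟩
      + 4 ℤ.- (((+ 2 + + 1 * + 2) + - m * m) + - n * n)
        ≡⟨ cong (λ z → + 4 ℤ.- (((z + + 1 * z) + - m * m) + - n * n)) (sym (root-norm root-x)) ⟩
      + 4 ℤ.- (((⟪ X , X ⟫ + + 1 * ⟪ X , X ⟫) + - m * m) + - n * n)
        ≡⟨ cong (ℤ._-_ (+ 4)) (sym (⟪⟫-residueˡ X A m B n X)) ⟩
      + 4 ℤ.- ⟪ w , X ⟫
        ≡⟨ cong (ℤ._-_ (+ 4)) (sum-0 λ i → sum-0 λ j → cong (λ z → z * cartan T i j * X j) (w≡0 i)) ⟩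
      + 4 ∎
      where
      rearrange : ∀ m n → m * m + n * n ≡ + 4 ℤ.- (((+ 2 + + 1 * + 2) + - m * m) + - n * n)
      rearrange = solve-∀

    pointwise : ∀ {x a b s t} → + 0 ℤ.≤ x → + 0 ℤ.≤ a → TwoZero s t →
      ((x + + 1 * x) + - s * a) + - t * b ≡ + 0 → x ≡ a
    pointwise {x} {a} {b} x≥0 a≥0 (inj₁ refl , refl) eq =
      ℤP.*-cancelˡ-≡ (+ 2) x a (ℤP.i-j≡0⇒i≡j _ _ (trans (halve x a b) eq))
      where
      halve : ∀ x a b → + 2 * x ℤ.- + 2 * a ≡ ((x + + 1 * x) + - (+ 2) * a) + - (+ 0) * b
      halve = solve-∀
    -- Here `x = - a`; both coordinates being nonnegative, they vanish, so `x ≡ a` holds for this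
    -- sign too.
    pointwise {x} {a} {b} x≥0 a≥0 (inj₂ refl , refl) eq = nonneg∧≡-⇒≡ x≥0 a≥0
      (ℤP.*-cancelˡ-≡ (+ 2) x (- a) (ℤP.i-j≡0⇒i≡j _ _ (trans (halve x a b) eq)))
      where
      halve : ∀ x a b → + 2 * x ℤ.- + 2 * - a ≡ ((x + + 1 * x) + - (- (+ 2)) * a) + - (+ 0) * b
      halve = solve-∀

    swap-terms : ∀ x m a n b → ((x + + 1 * x) + - n * b) + - m * a ≡ ((x + + 1 * x) + - m * a) + - n * b
    swap-terms = solve-∀

    conclude : TwoZero m n ⊎ TwoZero n m → x ≡ a ⊎ x ≡ b
    conclude (inj₁ tz) = inj₁ (lookup-ext λ i → pointwise {b = B i} (x≥0 i) (a≥0 i) tz (w≡0 i))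
    conclude (inj₂ tz) = inj₂ (lookup-ext λ i → pointwise {b = A i} (x≥0 i) (b≥0 i) tz
      (trans (swap-terms (X i) m (A i) n (B i)) (w≡0 i)))

-- The subsystem of type D₄

record D₄-Subdiagram (T : ADE) : Set where
  field
    vertex        : Fin 4 → Fin (rank T)
    vertex-cartan : ∀ a b → cartan T (vertex a) (vertex b) ≡ cartan (D 0) a b

D₄-embedding? : ∀ T (v : Fin 4 → Fin (rank T)) → Dec (∀ a b → cartan T (v a) (v b) ≡ cartan (D 0) a b)
D₄-embedding? T v = FP.all? λ a → FP.all? λ b → _ ℤ.≟ _

-- Counting from 0, the branch vertex of the E types is 3, with neighbours 1, 2 and 4; it takes
-- position 1, the centre of `D 0`.
E-vertex : ∀ {n} → Fin 4 → Fin (5 ℕ.+ n)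
E-vertex = lookup (1F ∷ 3F ∷ 2F ∷ 4F ∷ [])

D₄-subdiagram : ∀ T → D₄-Subdiagram T
D₄-subdiagram (D k) = record { vertex = k ↑ʳ_ ; vertex-cartan = shifted k }
  where
  shifted : ∀ k a b → cartan (D k) (k ↑ʳ a) (k ↑ʳ b) ≡ cartan (D 0) a b
  shifted zero    a b = refl
  shifted (suc k) a b = trans (cartan-D-suc k (k ↑ʳ a) (k ↑ʳ b)) (shifted k a b)
D₄-subdiagram E6 = record { vertex = E-vertex ; vertex-cartan = from-yes (D₄-embedding? E6 E-vertex) }
D₄-subdiagram E7 = record { vertex = E-vertex ; vertex-cartan = from-yes (D₄-embedding? E7 E-vertex) }
D₄-subdiagram E8 = record { vertex = E-vertex ; vertex-cartan = from-yes (D₄-embedding? E8 E-vertex) }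

pattern atˡ i = inj₁ i
pattern atᶜ j = inj₂ (inj₁ j)
pattern atᵈ k = inj₂ (inj₂ k)

infixr 5 _▹_

-- A word denotes the sum of its simple roots. Pairings of words compute in `D 0`, so facts about
-- them are decided once and carried to every `T`.
data Word : Set where
  [_] : Fin 4 → Word
  _▹_ : Fin 4 → Word → Word

word-pairing : Word → Fin 4 → ℤ
word-pairing [ a ]   b = cartan (D 0) a b
word-pairing (a ▹ u) b = cartan (D 0) a b + word-pairing u b

word-form : Word → Word → ℤ
word-form u [ b ]   = word-pairing u b
word-form u (b ▹ w) = word-pairing u b + word-form u w

-- The reflection in a simple root adds it to every root pairing to -1 with it.
IsRootWord : Word → Set
IsRootWord [ a ]   = ⊤
IsRootWord (a ▹ w) = word-pairing w a ≡ -[1+ 0 ] × IsRootWord w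

isRootWord? : ∀ w → Dec (IsRootWord w)
isRootWord? [ a ]   = yes tt
isRootWord? (a ▹ w) = (word-pairing w a ℤ.≟ -[1+ 0 ]) ×-dec isRootWord? w

word-length : Word → ℕ
word-length [ a ]   = 1
word-length (a ▹ w) = suc (word-length w)

-- In the numbering of D 0 the central vertex is 1.
leaf : Fin 3 → Fin 4
leaf 0F = 0F
leaf 1F = 2F
leaf 2F = 3F

-- Up to the highest root, the positive roots of D₄ are lʷ i (i ≠ 0), cʷ j and dʷ k,
-- with indices in the Klein four-group: {lʷ i}, {cʷ j} and {dʷ k} are the classes of
-- mutually orthogonal roots, and lʷ i, cʷ j, dʷ k are coplanar iff i + j = k.  The
-- nonzero element i of the group is represented by i - 1 in Fin 3.
lʷ : Fin 3 → Word
lʷ i = [ leaf i ]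

cʷ dʷ : Fin 4 → Word
cʷ 0F      = 0F ▹ 2F ▹ 3F ▹ [ 1F ]
cʷ (suc i) = leaf i ▹ [ 1F ]
dʷ 0F = [ 1F ]
dʷ 1F = 2F ▹ 3F ▹ [ 1F ]
dʷ 2F = 0F ▹ 3F ▹ [ 1F ]
dʷ 3F = 0F ▹ 2F ▹ [ 1F ]

klein : Fin 3 → Fin 4 → Fin 4
klein 0F = lookup (1F ∷ 0F ∷ 3F ∷ 2F ∷ [])
klein 1F = lookup (2F ∷ 3F ∷ 0F ∷ 1F ∷ [])
klein 2F = lookup (3F ∷ 2F ∷ 1F ∷ 0F ∷ [])

klein-injˡ : ∀ {i i'} j → klein i j ≡ klein i' j → i ≡ i'
klein-injˡ {i} {i'} j = from-yes (FP.all? λ i → FP.all? λ i' → FP.all? λ j →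
  (klein i j Fin.≟ klein i' j) →-dec (i Fin.≟ i')) i i' j

klein-injʳ : ∀ i {j j'} → klein i j ≡ klein i j' → j ≡ j'
klein-injʳ i {j} {j'} = from-yes (FP.all? λ i → FP.all? λ j → FP.all? λ j' →
  (klein i j Fin.≟ klein i j') →-dec (j Fin.≟ j')) i j j'

orthogonal-class? : ∀ (u : Fin 4 → Word) → Dec (∀ j j' → j ≢ j' → word-form (u j) (u j') ≡ + 0)
orthogonal-class? u = FP.all? λ j → FP.all? λ j' → ¬? (j Fin.≟ j') →-dec (_ ℤ.≟ _)

distinct-classes? : ∀ {m n} (u : Fin m → Word) (v : Fin n → Word) → Dec (∀ i j → word-form (u i) (v j) ≢ + 2)
distinct-classes? u v = FP.all? λ i → FP.all? λ j → ¬? (_ ℤ.≟ _)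

module InSubdiagram (T : ADE) where

  open RootSystem T
  open D₄-Subdiagram (D₄-subdiagram T)

  ⟦_⟧ : Word → Coord T
  ⟦ [ a ] ⟧   = simple T (vertex a)
  ⟦ a ▹ w ⟧ = addC T (simple T (vertex a)) ⟦ w ⟧

  pairing-word : ∀ u b → ⟪ lookup ⟦ u ⟧ , δ (vertex b) ⟫ ≡ word-pairing u b
  pairing-word [ a ] b = trans (⟪⟫-cong (lookup-simple (vertex a)) (λ _ → refl))
    (trans (⟪δ,δ⟫ (vertex a) (vertex b)) (vertex-cartan a b))
  pairing-word (a ▹ u) b = trans (⟪⟫-addCˡ (simple T (vertex a)) ⟦ u ⟧ (δ (vertex b)))
    (cong₂ _+_ (pairing-word [ a ] b) (pairing-word u b))

  form-word : ∀ u w → ⟪ lookup ⟦ u ⟧ , lookup ⟦ w ⟧ ⟫ ≡ word-form u w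
  form-word u [ b ] = trans (⟪⟫-cong {f = lookup ⟦ u ⟧} (λ _ → refl) (lookup-simple (vertex b))) (pairing-word u b)
  form-word u (b ▹ w) = trans (⟪⟫-sym (lookup ⟦ u ⟧) (lookup ⟦ b ▹ w ⟧))
    (trans (⟪⟫-addCˡ (simple T (vertex b)) ⟦ w ⟧ (lookup ⟦ u ⟧))
      (cong₂ _+_ (trans (⟪⟫-sym (lookup ⟦ [ b ] ⟧) (lookup ⟦ u ⟧)) (form-word u [ b ]))
        (trans (⟪⟫-sym (lookup ⟦ w ⟧) (lookup ⟦ u ⟧)) (form-word u w))))

  root-word : ∀ w → IsRootWord w → Root T ⟦ w ⟧
  root-word [ a ]   _ = simpleRoot (vertex a)
  root-word (a ▹ w) (p≡-1 , r) = subst (Root T) (lookup-ext reflected) (reflRoot (vertex a) (root-word w r))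
    where
    minus-minus : ∀ x s → x ℤ.- -[1+ 0 ] * s ≡ s + x
    minus-minus = solve-∀
    reflected : ∀ j → lookup (reflect T (vertex a) ⟦ w ⟧) j ≡ lookup ⟦ a ▹ w ⟧ j
    reflected j = trans (VP.lookup∘tabulate _ j) (trans
      (cong (λ p → lookup ⟦ w ⟧ j ℤ.- p * lookup (simple T (vertex a)) j)
        (trans (pairing≡⟪⟫ ⟦ w ⟧ (vertex a)) (trans (pairing-word w a) p≡-1)))
      (trans (minus-minus (lookup ⟦ w ⟧ j) (lookup (simple T (vertex a)) j))
        (sym (lookup-addC (simple T (vertex a)) ⟦ w ⟧ j))))

  word-nonneg : ∀ w j → + 0 ℤ.≤ lookup ⟦ w ⟧ j
  word-nonneg [ a ]   j = subst (+ 0 ℤ.≤_) (sym (lookup-simple (vertex a) j)) δ-nonneg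
    where
    δ-nonneg : + 0 ℤ.≤ δ (vertex a) j
    δ-nonneg with toℕ (vertex a) ℕ.≡ᵇ toℕ j
    ... | true  = ℤ.+≤+ z≤n
    ... | false = ℤ.+≤+ z≤n
  word-nonneg (a ▹ w) j = subst (+ 0 ℤ.≤_) (sym (lookup-addC (simple T (vertex a)) ⟦ w ⟧ j))
    (ℤP.+-mono-≤ (word-nonneg [ a ] j) (word-nonneg w j))

  height-simple : ∀ i → height T (simple T i) ≡ + 1
  height-simple i = trans (sumℤ-tabulate (δ i))
    (trans (sum-cong-≗ λ j → sym (ℤP.*-identityˡ (δ i j))) (sum-δ (λ _ → + 1) i))

  height-word : ∀ w → height T ⟦ w ⟧ ≡ + word-length w
  height-word [ a ]   = height-simple (vertex a)
  height-word (a ▹ w) = trans (sumℤ-zipWith (simple T (vertex a)) ⟦ w ⟧)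
    (cong₂ _+_ (height-simple (vertex a)) (height-word w))

  positive-word : ∀ w → IsRootWord w → Positive T ⟦ w ⟧
  positive-word w r = root-word w r , word-nonneg w

  -- Equal roots would pair to their norm 2. Distinctness is read off from the form because
  -- coordinates over a general `T` do not compute.
  word-form≢2⇒distinct : ∀ u w → IsRootWord u → word-form u w ≢ + 2 → ⟦ u ⟧ ≢ ⟦ w ⟧
  word-form≢2⇒distinct u w r ≢2 eq = ≢2 $ trans (sym (form-word u w))
    (trans (cong (λ x → ⟪ lookup ⟦ u ⟧ , lookup x ⟫) (sym eq)) (root-norm (root-word u r)))

  swap-letters : ∀ a b x → addC T (simple T (vertex a)) (addC T (simple T (vertex b)) x) ≡
                           addC T (simple T (vertex b)) (addC T (simple T (vertex a)) x)
  swap-letters a b x = trans (sym (VP.zipWith-assoc ℤP.+-assoc (simple T (vertex a)) _ x))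
    (trans (cong (λ y → addC T y x) (VP.zipWith-comm ℤP.+-comm (simple T (vertex a)) _))
      (VP.zipWith-assoc ℤP.+-assoc (simple T (vertex b)) _ x))

  -- The letter of `lʷ i` occurs in exactly one of `cʷ j` and `dʷ (klein i j)`, and deleting it
  -- leaves the other up to the order of letters; so one root is the sum of the two others.
  line : ∀ i j → Collinear (Hyp T ⟦ lʷ i ⟧) (Hyp T ⟦ cʷ j ⟧) (Hyp T ⟦ dʷ (klein i j) ⟧)
  line i j with decomposition i j
    where
    decomposition : ∀ i j → ⟦ dʷ (klein i j) ⟧ ≡ addC T ⟦ lʷ i ⟧ ⟦ cʷ j ⟧ ⊎
                            ⟦ cʷ j ⟧ ≡ addC T ⟦ lʷ i ⟧ ⟦ dʷ (klein i j) ⟧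
    decomposition 0F 0F = inj₂ refl
    decomposition 0F 1F = inj₂ refl
    decomposition 0F 2F = inj₁ refl
    decomposition 0F 3F = inj₁ refl
    decomposition 1F 0F = inj₂ (swap-letters 0F 2F _)
    decomposition 1F 1F = inj₁ (swap-letters 0F 2F _)
    decomposition 1F 2F = inj₂ refl
    decomposition 1F 3F = inj₁ refl
    decomposition 2F 0F = inj₂ (trans (cong (addC T _) (swap-letters 2F 3F _)) (swap-letters 0F 3F _))
    decomposition 2F 1F = inj₁ (swap-letters 0F 3F _)
    decomposition 2F 2F = inj₁ (swap-letters 2F 3F _)
    decomposition 2F 3F = inj₂ refl
  ... | inj₁ d≡l+c = subst (λ x → Collinear (Hyp T ⟦ lʷ i ⟧) (Hyp T ⟦ cʷ j ⟧) (Hyp T x)) (sym d≡l+c)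
    (addC-collinear ⟦ lʷ i ⟧ ⟦ cʷ j ⟧)
  ... | inj₂ c≡l+d = subst (λ x → Collinear (Hyp T ⟦ lʷ i ⟧) (Hyp T x) (Hyp T ⟦ dʷ (klein i j) ⟧)) (sym c≡l+d)
    (flip (addC-collinear ⟦ lʷ i ⟧ ⟦ dʷ (klein i j) ⟧))
    where
    flip : ∀ {X Y Z : Sub (rank T)} → Collinear X Y Z → Collinear X Z Y
    flip r = record { meet₁₂ = meet₁₃ ; meet₁₃ = meet₁₂ ; meet₂₃ = λ v (z , y) → meet₂₃ v (y , z) }
      where open Collinear r

l-root : ∀ i → IsRootWord (lʷ i)
l-root i = tt

c-root : ∀ j → IsRootWord (cʷ j)
c-root = from-yes (FP.all? λ j → isRootWord? (cʷ j))

d-root : ∀ k → IsRootWord (dʷ k)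
d-root = from-yes (FP.all? λ k → isRootWord? (dʷ k))

c-orthogonal : ∀ j j' → j ≢ j' → word-form (cʷ j) (cʷ j') ≡ + 0
c-orthogonal = from-yes (orthogonal-class? cʷ)

d-orthogonal : ∀ k k' → k ≢ k' → word-form (dʷ k) (dʷ k') ≡ + 0
d-orthogonal = from-yes (orthogonal-class? dʷ)

-- Each number is at most the maximum of the other two, so the maximum is attained twice.
two-equal : ∀ {x y z} →
  (∀ {m} → x ℕ.≤ m → y ℕ.≤ m → z ℕ.≤ m) →
  (∀ {m} → x ℕ.≤ m → z ℕ.≤ m → y ℕ.≤ m) →
  (∀ {m} → y ℕ.≤ m → z ℕ.≤ m → x ℕ.≤ m) →
  x ≡ y ⊎ x ≡ z ⊎ y ≡ z
two-equal {x} {y} {z} xy xz yz with ℕP.≤-total x y | ℕP.≤-total x z | ℕP.≤-total y z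
... | inj₁ x≤y | inj₁ x≤z | _ = inj₂ (inj₂ (ℕP.≤-antisym (xz x≤z ℕP.≤-refl) (xy x≤y ℕP.≤-refl)))
... | inj₁ x≤y | inj₂ z≤x | _ = inj₁ (ℕP.≤-antisym x≤y (xz ℕP.≤-refl z≤x))
... | inj₂ y≤x | _ | inj₁ y≤z = inj₂ (inj₁ (ℕP.≤-antisym (yz y≤z ℕP.≤-refl) (xy ℕP.≤-refl y≤x)))
... | inj₂ y≤x | _ | inj₂ z≤y = inj₁ (ℕP.≤-antisym (yz ℕP.≤-refl z≤y) y≤x)

-- Labels and levels in the arrangement of an ideal

module Arrangement (T : ADE) (I : Coord T → Set) where

  open RootSystem T
  open InSubdiagram T

  M : Coord T → Set
  M = AI-names T I

  low-word-in-M : ∀ {t} → (∀ α → I α → Iht T t α) → ∀ w → IsRootWord w → word-length w ℕ.< t → M ⟦ w ⟧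
  low-word-in-M I⊆ w r low = positive-word w r , λ Iw →
    ℕP.<⇒≱ low (ℤP.drop‿+≤+ (subst (_ ℤ.≤_) (height-word w) (proj₂ (I⊆ _ Iw))))

  only-two : ∀ u w → IsRootWord u → IsRootWord w → word-form u w ≡ + 0 → ∀ x → M x →
    (Hyp T ⟦ u ⟧ ∩S Hyp T ⟦ w ⟧) ⊆S Hyp T x → x ≡ ⟦ u ⟧ ⊎ x ≡ ⟦ w ⟧
  only-two u w ru rw u⊥w x (x⁺ , _) = orthogonal-pair-generic {⟦ u ⟧} {⟦ w ⟧} {x}
    (positive-word u ru) (positive-word w rw) x⁺ (trans (form-word u w) u⊥w)

  -- The longest of the eleven words, `cʷ 0F`, has four letters, so the bound 5 puts all of them in
  -- `M`.
  not-inductivelyFactored : (∀ α → I α → Iht T 5 α) → ¬ InductivelyFactored (Hyp T) M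
  not-inductivelyFactored I⊆ (lab , fact) = ℕP.<⇒≱ (s≤s (ℕP.m≤m+n 10 1)) lines≤slots′
    where
    in-M : ∀ w → IsRootWord w → word-length w ℕ.< 5 → M ⟦ w ⟧
    in-M = low-word-in-M I⊆

    l∈M : ∀ i → M ⟦ lʷ i ⟧
    l∈M i = in-M (lʷ i) (l-root i) (s≤s (s≤s z≤n))
    c∈M : ∀ j → M ⟦ cʷ j ⟧
    c∈M j = in-M (cʷ j) (c-root j) (from-yes (FP.all? λ j → word-length (cʷ j) ℕ.<? 5) j)
    d∈M : ∀ k → M ⟦ dʷ k ⟧
    d∈M k = in-M (dʷ k) (d-root k) (from-yes (FP.all? λ k → word-length (dʷ k) ℕ.<? 5) k)

    labels-injective : (u : Fin 4 → Word) → (∀ j → IsRootWord (u j)) → (∀ j → M ⟦ u j ⟧) →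
      (∀ j j' → j ≢ j' → word-form (u j) (u j') ≡ + 0) → Injective _≡_ _≡_ (λ j → lab ⟦ u j ⟧)
    labels-injective u root in-M orth {j} {j'} eq with j Fin.≟ j'
    ... | yes j≡j' = j≡j'
    ... | no j≢j' = ⊥-elim (generic⇒distinct-labels (VP.≡-dec ℤ._≟_)
      (orthogonal-roots-distinct {b = ⟦ u j' ⟧} (root-word (u j) (root j)) (trans (form-word (u j) (u j')) (orth j j' j≢j')))
      (only-two (u j) (u j') (root j) (root j') (orth j j' j≢j')) fact (in-M j) (in-M j') eq)

    open Levels (λ i → lab ⟦ lʷ i ⟧) (λ j → lab ⟦ cʷ j ⟧) (λ k → lab ⟦ dʷ k ⟧) klein klein-injˡ klein-injʳ
      (labels-injective cʷ c-root c∈M c-orthogonal) (labels-injective dʷ d-root d∈M d-orthogonal)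

    choice : ∀ k → ∃ (Hit k)
    choice (i , j) with lab ⟦ lʷ i ⟧ ℕ.≟ lab ⟦ cʷ j ⟧
                      | lab ⟦ lʷ i ⟧ ℕ.≟ lab ⟦ dʷ (klein i j) ⟧
                      | lab ⟦ cʷ j ⟧ ℕ.≟ lab ⟦ dʷ (klein i j) ⟧
    ... | yes eq | _ | _ = _ , first-second eq
    ... | no _ | yes eq | _ = _ , first-third eq
    ... | no _ | no _ | yes eq = _ , second-third eq
    ... | no lc | no ld | no cd = ⊥-elim (collinear⇒share-label (VP.≡-dec ℤ._≟_) (line i j)
      (word-form≢2⇒distinct (lʷ i) (cʷ j) (l-root i) (from-yes (distinct-classes? lʷ cʷ) i j))
      (word-form≢2⇒distinct (lʷ i) (dʷ k) (l-root i) (from-yes (distinct-classes? lʷ dʷ) i k))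
      (word-form≢2⇒distinct (cʷ j) (dʷ k) (c-root j) (from-yes (distinct-classes? cʷ dʷ) j k))
      fact (l∈M i) (c∈M j) (d∈M k) (lc , ld , cd))
      where
      k : Fin 4
      k = klein i j

    lines≤slots′ : 12 ℕ.≤ 10
    lines≤slots′ = lines≤slots choice

  -- The bound 4 guarantees only the words of at most three letters, that is, all except `cʷ 0F`;
  -- hence the `c` class is indexed by `Fin 3` through `suc`.
  not-supersolvable : (∀ α → I α → Iht T 4 α) → ¬ Supersolvable (Hyp T) M
  -- Levels exist only up to double negation, which suffices for the empty goal.
  not-supersolvable I⊆ chain = levelsFrom (Hyp T) M Hyp-linear name points in-M chain
    λ (level , levels) → contradictory level levels
    where
    Point : Set
    Point = Fin 3 ⊎ (Fin 3 ⊎ Fin 4)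

    points : Omniscient Point
    points = omniscient-⊎ (omniscient-Fin 3) (omniscient-⊎ (omniscient-Fin 3) (omniscient-Fin 4))

    word : Point → Word
    word (atˡ i) = lʷ i
    word (atᶜ j) = cʷ (suc j)
    word (atᵈ k) = dʷ k

    name : Point → Coord T
    name i = ⟦ word i ⟧

    in-M : ∀ i → M (name i)
    in-M (atˡ i) = low-word-in-M I⊆ (lʷ i) (l-root i) (s≤s (s≤s z≤n))
    in-M (atᶜ j) = low-word-in-M I⊆ (cʷ (suc j)) (c-root (suc j)) (s≤s (s≤s (s≤s z≤n)))
    in-M (atᵈ k) = low-word-in-M I⊆ (dʷ k) (d-root k) (from-yes (FP.all? λ k → word-length (dʷ k) ℕ.<? 4) k)

    separated : ∀ u w → IsRootWord w → word-form u w ≡ + 0 → ∃ λ v → Hyp T ⟦ u ⟧ v × ¬ Hyp T ⟦ w ⟧ v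
    separated u w rw u⊥w = fromℤ (lookup ⟦ w ⟧) , ⊥⇒Hyp ⟦ u ⟧ (lookup ⟦ w ⟧) (trans (form-word u w) u⊥w) ,
      λ h → contradiction (trans (sym (root-norm (root-word w rw))) (Hyp⇒⊥ ⟦ w ⟧ (lookup ⟦ w ⟧) h)) λ ()

    generic : ∀ u w → IsRootWord u → IsRootWord w → word-form u w ≡ + 0 → Generic (Hyp T) M Hyp-linear ⟦ u ⟧ ⟦ w ⟧
    generic u w ru rw u⊥w = record { only = only-two u w ru rw u⊥w ; separated = separated u w rw u⊥w }

    module _ (level : Point → ℕ) (levels : LevelsFrom (Hyp T) M Hyp-linear name fullS level) where

      open LevelsFrom levels renaming (generic to generic⇒0)

      orthogonal⇒distinct : ∀ {i j} → IsRootWord (word i) → IsRootWord (word j) →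
        word-form (word i) (word j) ≡ + 0 → word-form (word j) (word i) ≡ + 0 → level i ≢ level j
      orthogonal⇒distinct {i} {j} ri rj i⊥j j⊥i eq with separated (word j) (word i) ri j⊥i
      -- Level 0 would put the full space inside the hyperplane of `i`, but `v` lies outside it.
      ... | v , _ , v∉i = v∉i (zero⇒⊆ (generic⇒0 (generic (word i) (word j) ri rj i⊥j) eq) v _)

      c-injective : Injective _≡_ _≡_ (λ j → level (atᶜ j))
      c-injective {j} {j'} eq with j Fin.≟ j'
      ... | yes j≡j' = j≡j'
      ... | no j≢j' = ⊥-elim (orthogonal⇒distinct {atᶜ j} {atᶜ j'} (c-root (suc j)) (c-root (suc j'))
              (c-orthogonal (suc j) (suc j') (j≢j' ∘ FP.suc-injective))
              (c-orthogonal (suc j') (suc j) (j≢j' ∘ sym ∘ FP.suc-injective)) eq)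

      d-injective : Injective _≡_ _≡_ (λ k → level (atᵈ k))
      d-injective {k} {k'} eq with k Fin.≟ k'
      ... | yes k≡k' = k≡k'
      ... | no k≢k' = ⊥-elim (orthogonal⇒distinct {atᵈ k} {atᵈ k'} (d-root k) (d-root k')
              (d-orthogonal k k' k≢k') (d-orthogonal k' k (k≢k' ∘ sym)) eq)

      open Levels (λ i → level (atˡ i)) (λ j → level (atᶜ j)) (λ k → level (atᵈ k))
        (λ i j → klein i (suc j)) (λ j → klein-injˡ (suc j)) (λ i → FP.suc-injective ∘ klein-injʳ i)
        c-injective d-injective

      choice : ∀ k → ∃ (Hit k)
      choice (i , j) with two-equal
          (λ {m} → span {atˡ i} {atᶜ j} {atᵈ (klein i (suc j))} (meet₁₂ (line i (suc j))) {m})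
          (λ {m} → span {atˡ i} {atᵈ (klein i (suc j))} {atᶜ j} (meet₁₃ (line i (suc j))) {m})
          (λ {m} → span {atᶜ j} {atᵈ (klein i (suc j))} {atˡ i} (meet₂₃ (line i (suc j))) {m})
        where open Collinear
      ... | inj₁ eq        = _ , first-second eq
      ... | inj₂ (inj₁ eq) = _ , first-third eq
      ... | inj₂ (inj₂ eq) = _ , second-third eq

      contradictory : ⊥
      -- `refl` is the count 3 · 3 = 3 + (3 + 3). When a `c` and a `d` share a level, `span` puts
      -- the `l` on their line at or below it.
      contradictory = no-levels choice refl
        (λ i j eq → span {atᶜ j} {atᵈ (klein i (suc j))} {atˡ i} (Collinear.meet₂₃ (line i (suc j)))
          ℕP.≤-refl (ℕP.≤-reflexive (sym eq))) zero

theorem1p30 : (T : ADE) (I : Coord T → Set) → IsIdeal T I →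
    ((∀ α → I α → Iht T 4 α) → ¬ Supersolvable (Hyp T) (AI-names T I)) ×
    ((∀ α → I α → Iht T 5 α) → ¬ InductivelyFactored (Hyp T) (AI-names T I))
theorem1p30 T I _ = Arrangement.not-supersolvable T I , Arrangement.not-inductivelyFactored T I
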